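{- Let $q\ge 1$ and $n\ge q+3$ be integers. Then $\mathrm{sat}(n, K_1\vee(K_{2}\cup qK_1))=n-1$. Furthermore: if $q=1$, then $\mathrm{SAT}(n, K_1\vee(K_2\cup qK_1))$ consists exactly, up to isomorphism, of $S_n$ and the graphs $aK_3\cup S_{n-3a}$, where $a$ ranges over the positive integers with $n>3a$ and $n-3a\neq 3$; if $q\ge 2$, then $\mathrm{SAT}(n, K_1\vee(K_2\cup qK_1))=\{S_n\}$ up to isomorphism.
   Context: All graphs are finite and simple. For graphs $F$ and $G$, $G$ is $F$-saturated if $G$ contains no copy of $F$ as a (not necessarily induced) subgraph, but for every edge $e$ of the complement $\overline{G}$, the graph $G+e$ obtained by adding $e$ to $G$ contains a copy of $F$. The saturation number $\mathrm{sat}(n,F)$ is the minimum number of edges in an $F$-saturated graph on $n$ vertices, and $\mathrm{SAT}(n,F)$ is the set (up to isomorphism) of $F$-saturated graphs on $n$ vertices with exactly $\mathrm{sat}(n,F)$ edges. $K_m$ is the complete graph on $m$ vertices, $S_m$ is the star on $m$ vertices (one center adjacent to $m-1$ leaves; $S_1=K_1$, $S_2=K_2$), $\cup$ denotes vertex-disjoint union, $mG$ denotes the disjoint union of $m$ copies of $G$, and $G_1\vee G_2$ is the join, obtained from the disjoint union $G_1\cup G_2$ by adding all edges between $V(G_1)$ and $V(G_2)$. -}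

module Defs where

open import Level using (0ℓ)
open import Data.Empty using (⊥)
open import Data.Fin using (Fin; zero; suc; splitAt)
open import Data.Fin.Properties using (_≟_; _<?_)
open import Data.List using (List; length; filter; allFin; cartesianProduct)
open import Data.Nat using (ℕ; zero; suc; _+_; _*_; _≤_)
open import Data.Product using (Σ-syntax; _×_; _,_)
open import Data.Sum as Sum using (_⊎_; inj₁; inj₂)
open import Data.Sum.Relation.Binary.Pointwise
  using (Pointwise; inj₁; inj₂; ⊎-symmetric; ⊎-decidable)
open import Data.Unit using (⊤; tt)
open import Function.Base using (_∘_)
open import Function.Bundles using (_↔_; _⇔_; Inverse)
open import Function.Definitions using (Injective)
open import Relation.Binary.Core using (Rel)
open import Relation.Binary.Definitions using (Symmetric; Irreflexive; Decidable)
open import Relation.Binary.PropositionalEquality using (_≡_; _≢_; refl; sym)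
open import Relation.Nullary using (¬_; yes; no)
open import Relation.Nullary.Decidable using (¬?; _×-dec_; _⊎-dec_)

-- Finite simple graphs on the vertex set Fin n.  Decidability of adjacency is
-- what makes the edges of a graph countable constructively.
record Graph (n : ℕ) : Set₁ where
  infix 4 _~_ _~?_
  field
    _~_      : Rel (Fin n) 0ℓ
    ~-sym    : Symmetric _~_
    ~-irrefl : Irreflexive _≡_ _~_
    _~?_     : Decidable _~_

-- Every edge is listed once, as the pair (u , v) with u < v.
E : ∀ {n} → Graph n → List (Fin n × Fin n)
E {n} G = filter (λ (u , v) → (u <? v) ×-dec (u ~? v))
                 (cartesianProduct (allFin n) (allFin n))
  where open Graph G

e : ∀ {n} → Graph n → ℕ
e G = length (E G)

-- The orders of G and H are separate indices, so that graphs whose orders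
-- are equal only propositionally can be compared.
infix 3 _≅_
_≅_ : ∀ {m n} → Graph m → Graph n → Set
_≅_ {m} {n} G H =
  Σ[ φ ∈ Fin m ↔ Fin n ]
    (∀ u v → (Graph._~_ G u v ⇔ Graph._~_ H (Inverse.to φ u) (Inverse.to φ v)))

-- F ⊑ G: G contains a copy of F as a not necessarily induced subgraph.
infix 3 _⊑_
_⊑_ : ∀ {m n} → Graph m → Graph n → Set
_⊑_ {m} {n} F G =
  Σ[ f ∈ (Fin m → Fin n) ]
    (Injective _≡_ _≡_ f × (∀ {u v} → Graph._~_ F u v → Graph._~_ G (f u) (f v)))

complement : ∀ {n} → Graph n → Graph n
complement G = record
  { _~_      = λ u v → u ≢ v × ¬ (u ~ v)
  ; ~-sym    = λ (u≢v , u≁v) → u≢v ∘ sym , u≁v ∘ ~-sym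
  ; ~-irrefl = λ u≡v (u≢v , _) → u≢v u≡v
  ; _~?_     = λ u v → ¬? (u ≟ v) ×-dec ¬? (u ~? v)
  }
  where open Graph G

addEdge : ∀ {n} → Graph n → (u v : Fin n) → u ≢ v → Graph n
addEdge G u v u≢v = record
  { _~_      = λ x y → x ~ y ⊎ (x ≡ u × y ≡ v) ⊎ (y ≡ u × x ≡ v)
  ; ~-sym    = Sum.map ~-sym Sum.swap
  ; ~-irrefl = λ { refl (inj₁ x~x)                  → ~-irrefl refl x~x
                 ; refl (inj₂ (inj₁ (refl , refl))) → u≢v refl
                 ; refl (inj₂ (inj₂ (refl , refl))) → u≢v refl }
  ; _~?_     = λ x y → (x ~? y) ⊎-dec
                       (((x ≟ u) ×-dec (y ≟ v)) ⊎-dec ((y ≟ u) ×-dec (x ≟ v)))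
  }
  where open Graph G

Saturated : ∀ {m n} → Graph m → Graph n → Set
Saturated F G =
  ¬ (F ⊑ G) ×
  (∀ u v (uv : Graph._~_ (complement G) u v) →
     F ⊑ addEdge G u v (λ u≡v → Graph.~-irrefl (complement G) u≡v uv))

IsMinimum : ∀ {ℓ} → (ℕ → Set ℓ) → ℕ → Set ℓ
IsMinimum P k = P k × (∀ j → P j → k ≤ j)

-- IsSat n F k: sat(n,F) = k.  A relation rather than a function, since an
-- edgeless F may admit no F-saturated graph on n vertices.
IsSat : ∀ {m} → ℕ → Graph m → ℕ → Set₁
IsSat n F = IsMinimum (λ k → Σ[ G ∈ Graph n ] (Saturated F G × e G ≡ k))

-- SAT n F G: G belongs to SAT(n,F).
SAT : ∀ {m} (n : ℕ) → Graph m → Graph n → Set₁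
SAT n F G = Saturated F G × IsSat n F (e G)

K : (m : ℕ) → Graph m
K m = record
  { _~_      = _≢_
  ; ~-sym    = λ u≢v → u≢v ∘ sym
  ; ~-irrefl = λ u≡v u≢v → u≢v u≡v
  ; _~?_     = λ u v → ¬? (u ≟ v)
  }

-- The star on m vertices, with centre zero; S 0 is the graph without vertices.
S : (m : ℕ) → Graph m
S m = record { _~_ = adj ; ~-sym = λ {u} {v} → adj-sym u v
             ; ~-irrefl = λ {u} {v} → adj-irrefl u v ; _~?_ = adj? }
  where
  adj : ∀ {m} → Rel (Fin m) 0ℓ
  adj zero    zero    = ⊥
  adj zero    (suc _) = ⊤
  adj (suc _) zero    = ⊤
  adj (suc _) (suc _) = ⊥

  adj-sym : ∀ {m} (u v : Fin m) → adj u v → adj v u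
  adj-sym zero    (suc _) _ = tt
  adj-sym (suc _) zero    _ = tt

  adj-irrefl : ∀ {m} (u v : Fin m) → u ≡ v → ¬ adj u v
  adj-irrefl zero    .zero    refl ()
  adj-irrefl (suc _) .(suc _) refl ()

  adj? : ∀ {m} → Decidable (adj {m})
  adj? zero    zero    = no λ ()
  adj? zero    (suc _) = yes tt
  adj? (suc _) zero    = yes tt
  adj? (suc _) (suc _) = no λ ()

-- In G₁ ∪ G₂ and G₁ ∨ G₂ the first m vertices are those of G₁.
infixr 6 _∪_
_∪_ : ∀ {m n} → Graph m → Graph n → Graph (m + n)
_∪_ {m} G₁ G₂ = record
  { _~_      = λ u v → Pointwise G₁._~_ G₂._~_ (splitAt m u) (splitAt m v)
  ; ~-sym    = ⊎-symmetric G₁.~-sym G₂.~-sym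
  ; ~-irrefl = λ { {u} refl → irr (splitAt m u) }
  ; _~?_     = λ u v → ⊎-decidable G₁._~?_ G₂._~?_ (splitAt m u) (splitAt m v)
  }
  where
  module G₁ = Graph G₁
  module G₂ = Graph G₂

  irr : ∀ x → ¬ Pointwise G₁._~_ G₂._~_ x x
  irr (inj₁ _) (inj₁ p) = G₁.~-irrefl refl p
  irr (inj₂ _) (inj₂ p) = G₂.~-irrefl refl p

infixr 5 _∨_
_∨_ : ∀ {m n} → Graph m → Graph n → Graph (m + n)
_∨_ {m} {n} G₁ G₂ = record
  { _~_      = λ u v → adj (splitAt m u) (splitAt m v)
  ; ~-sym    = λ {u} {v} → adj-sym (splitAt m u) (splitAt m v)
  ; ~-irrefl = λ { {u} refl → irr (splitAt m u) }
  ; _~?_     = λ u v → adj? (splitAt m u) (splitAt m v)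
  }
  where
  module G₁ = Graph G₁
  module G₂ = Graph G₂

  adj : Rel (Fin m ⊎ Fin n) 0ℓ
  adj (inj₁ u) (inj₁ v) = u G₁.~ v
  adj (inj₁ _) (inj₂ _) = ⊤
  adj (inj₂ _) (inj₁ _) = ⊤
  adj (inj₂ u) (inj₂ v) = u G₂.~ v

  adj-sym : ∀ x y → adj x y → adj y x
  adj-sym (inj₁ _) (inj₁ _) p = G₁.~-sym p
  adj-sym (inj₁ _) (inj₂ _) _ = tt
  adj-sym (inj₂ _) (inj₁ _) _ = tt
  adj-sym (inj₂ _) (inj₂ _) p = G₂.~-sym p

  irr : ∀ x → ¬ adj x x
  irr (inj₁ _) = G₁.~-irrefl refl
  irr (inj₂ _) = G₂.~-irrefl refl

  adj? : Decidable adj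
  adj? (inj₁ u) (inj₁ v) = u G₁.~? v
  adj? (inj₁ _) (inj₂ _) = yes tt
  adj? (inj₂ _) (inj₁ _) = yes tt
  adj? (inj₂ u) (inj₂ v) = u G₂.~? v

-- a · G is the disjoint union of a copies of G.
infixr 7 _·_
_·_ : ∀ {n} (a : ℕ) → Graph n → Graph (a * n)
zero  · G = K 0
suc a · G = G ∪ (a · G)

{-# OPTIONS --safe #-}
module Submission where

-- A copy of F = K₁ ∨ (K₂ ∪ qK₁) is a vertex of degree at least q + 2 lying on a triangle.
-- So in an F-saturated graph two non-adjacent vertices have a common neighbour unless one
-- of them lies on a triangle and has degree q + 1.  Let r be a vertex on no triangle (any
-- vertex, if there is none): every other vertex is at distance at most 2 from r or has
-- degree at least 2.  Charging to the former both orientations of the edge to its BFS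
-- parent, and to the latter two darts leaving it, charges 2(n − 1) distinct darts among
-- the 2e(G).  If e(G) = n − 1 then every dart is charged: the ball of radius 2 around r is
-- a tree component, which saturation forces to be a star, and all other vertices have
-- degree exactly 2, which makes q = 1 and puts them into K₃ components.

open import Defs
open import Data.Empty using (⊥; ⊥-elim)
open import Data.Fin as Fin
  using (Fin; zero; suc; remQuot; combine; punchIn; punchOut; _↑ˡ_; _↑ʳ_; splitAt; inject≤)
open import Data.Fin.Permutation using (↔⇒≡)
open import Data.Fin.Properties as Fin
  using (_≟_; any?; injective⇒≤; punchInᵢ≢i; punchIn-injective; punchIn-punchOut)
open import Data.List using (List; lookup; filter; length; allFin; cartesianProduct)
open import Data.List.Membership.Propositional.Properties
  using (∈-lookup; ∈-filter⁺; ∈-filter⁻; ∈-cartesianProduct⁺; ∈-allFin)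
open import Data.List.Relation.Unary.All as All using ()
open import Data.List.Relation.Unary.AllPairs using (_∷_)
open import Data.List.Relation.Unary.Any using (index)
open import Data.List.Relation.Unary.Any.Properties using (lookup-index)
open import Data.List.Relation.Unary.Unique.Propositional using (Unique)
open import Data.List.Relation.Unary.Unique.Propositional.Properties
  using (filter⁺; cartesianProduct⁺; allFin⁺)
open import Data.Nat as ℕ using (ℕ; zero; suc; _+_; _*_; _∸_; _≤_; _<_; s≤s; z≤n)
open import Data.Nat.Properties as ℕ using ()
open import Data.Product using (Σ-syntax; ∃; ∃₂; _×_; _,_; proj₁; proj₂; uncurry; swap)
open import Data.Sum as Sum using (_⊎_; inj₁; inj₂; [_,_]′; assocʳ)
open import Data.Sum.Relation.Binary.Pointwise using (Pointwise; inj₁; inj₂)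
open import Data.Unit using (tt)
open import Function.Base using (_∘_; id)
open import Function.Bundles using (_⇔_; Equivalence; Inverse; mk⇔; mk↔ₛ′)
open import Function.Definitions using (Injective)
import Function.Properties.Equivalence as ⇔
open import Relation.Binary.Definitions using (tri<; tri≈; tri>)
open import Relation.Binary.PropositionalEquality
  using (_≡_; _≢_; refl; sym; trans; cong; cong₂; subst; subst₂)
open import Relation.Nullary using (¬_; Dec; yes; no; contradiction)
open import Relation.Nullary.Decidable using (¬?; _×-dec_; _⊎-dec_; decidable-stable)

private
  variable
    k l m n q : ℕ

pattern 0F = zero
pattern 1F = suc zero
pattern 2F = suc (suc zero)

-- Injections between finite sets.

lookup-injective : ∀ {A : Set} {xs : List A} → Unique xs → Injective _≡_ _≡_ (lookup xs)
lookup-injective (_ ∷ _)   {zero}  {zero}  _  = refl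
lookup-injective (≢s ∷ _)  {zero}  {suc j} eq = contradiction eq (All.lookup ≢s (∈-lookup j))
lookup-injective (≢s ∷ _)  {suc i} {zero}  eq = contradiction (sym eq) (All.lookup ≢s (∈-lookup i))
lookup-injective (_ ∷ uxs) {suc i} {suc j} eq = cong suc (lookup-injective uxs eq)

-- If `j` were missed, punching it out of the codomain would inject a finite set into a smaller one.
injective⇒covers : {f : Fin n → Fin n} → Injective _≡_ _≡_ f → ∀ j → ∃ λ i → f i ≡ j
injective⇒covers {suc n} {f} f-inj j with any? (λ i → f i ≟ j)
... | yes hit  = hit
... | no  miss = contradiction
  (injective⇒≤ {f = λ i → punchOut (j≢f i)} (λ eq → f-inj (Fin.punchOut-injective (j≢f _) (j≢f _) eq)))
  ℕ.1+n≰n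
  where
  j≢f : ∀ i → j ≢ f i
  j≢f i eq = miss (i , sym eq)

-- Conjugation with the bijection between `Fin k × Fin m` and `Fin (k * m)`, which carries the
-- pigeonhole principle over to pairs.
flatten : (Fin k × Fin m → Fin l × Fin m) → Fin (k * m) → Fin (l * m)
flatten {m = m} f = uncurry combine ∘ f ∘ remQuot m

flatten-injective : {f : Fin k × Fin m → Fin l × Fin m} →
                    Injective _≡_ _≡_ f → Injective _≡_ _≡_ (flatten f)
flatten-injective {k} {m} f-inj {i} {j} eq =
  trans (sym (Fin.combine-remQuot {k} m i))
    (trans (cong (uncurry combine) (f-inj (cong₂ _,_ (proj₁ eqs) (proj₂ eqs))))
           (Fin.combine-remQuot {k} m j))
  where eqs = Fin.combine-injective _ _ _ _ eq

×-injective⇒≤ : .{{_ : ℕ.NonZero m}} {f : Fin k × Fin m → Fin l × Fin m} →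
                Injective _≡_ _≡_ f → k ≤ l
×-injective⇒≤ f-inj = ℕ.*-cancelʳ-≤ _ _ _ (injective⇒≤ (flatten-injective f-inj))

×-injective⇒covers : {f : Fin k × Fin m → Fin k × Fin m} →
                     Injective _≡_ _≡_ f → ∀ y → ∃ λ x → f x ≡ y
×-injective⇒covers {m = m} f-inj (a , b)
  with i , eq ← injective⇒covers (flatten-injective f-inj) (combine a b)
  with eqs ← Fin.combine-injective _ _ _ _ eq
  = remQuot m i , cong₂ _,_ (proj₁ eqs) (proj₂ eqs)

-- Darts and the counting of edges.

-- A dart is an ordered pair of adjacent vertices; each edge carries two.
module Darts (G : Graph n) where
  open Graph G

  private
    edge? : ∀ ((u , v) : Fin n × Fin n) → Dec (u Fin.< v × u ~ v)
    edge? (u , v) = (u Fin.<? v) ×-dec (u ~? v)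

  E-unique : Unique (E G)
  E-unique = filter⁺ edge? (cartesianProduct⁺ (allFin⁺ n) (allFin⁺ n))

  dart : Fin (e G) × Fin 2 → Fin n × Fin n
  dart (i , zero)  = lookup (E G) i
  dart (i , suc _) = swap (lookup (E G) i)

  E-ordered : ∀ i → let u , v = lookup (E G) i in u Fin.< v × u ~ v
  E-ordered i = proj₂ (∈-filter⁻ edge? {xs = cartesianProduct (allFin n) (allFin n)} (∈-lookup i))

  dart-~ : ∀ d → uncurry _~_ (dart d)
  dart-~ (i , zero)  = proj₂ (E-ordered i)
  dart-~ (i , suc _) = ~-sym (proj₂ (E-ordered i))

  dart-injective : Injective _≡_ _≡_ dart
  dart-injective {i , 0F} {j , 0F} eq = cong (_, 0F) (lookup-injective E-unique eq)
  dart-injective {i , 1F} {j , 1F} eq = cong (_, 1F) (lookup-injective E-unique (cong swap eq))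
  -- Listed pairs are increasing, so no listed pair is the reverse of a listed pair.
  dart-injective {i , 0F} {j , 1F} eq =
    contradiction (subst₂ Fin._<_ (cong proj₁ eq) (cong proj₂ eq) (proj₁ (E-ordered i)))
                  (Fin.<-asym (proj₁ (E-ordered j)))
  dart-injective {i , 1F} {j , 0F} eq =
    contradiction (subst₂ Fin._<_ (cong proj₂ eq) (cong proj₁ eq) (proj₁ (E-ordered i)))
                  (Fin.<-asym (proj₁ (E-ordered j)))

  E-covers : ∀ {u v} → u Fin.< v → u ~ v → ∃ λ i → lookup (E G) i ≡ (u , v)
  E-covers u<v u~v = index uv∈E , sym (lookup-index uv∈E)
    where uv∈E = ∈-filter⁺ edge? (∈-cartesianProduct⁺ (∈-allFin _) (∈-allFin _)) (u<v , u~v)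

  dart-covers : ∀ {u v} → u ~ v → ∃ λ d → dart d ≡ (u , v)
  dart-covers {u} {v} u~v with Fin.<-cmp u v
  ... | tri< u<v _ _ = let i , eq = E-covers u<v u~v in (i , 0F) , eq
  ... | tri≈ _ u≡v _ = contradiction u~v (~-irrefl u≡v)
  ... | tri> _ _ v<u = let i , eq = E-covers v<u (~-sym u~v) in (i , 1F) , cong swap eq

  module _ (κ : Fin m × Fin 2 → Fin n × Fin n) where

    private
      code : (∀ x → uncurry _~_ (κ x)) → Fin m × Fin 2 → Fin (e G) × Fin 2
      code κ-~ x = proj₁ (dart-covers (κ-~ x))

      dart-code : ∀ κ-~ x → dart (code κ-~ x) ≡ κ x
      dart-code κ-~ x = proj₂ (dart-covers (κ-~ x))

      code-injective : ∀ κ-~ → Injective _≡_ _≡_ κ → Injective _≡_ _≡_ (code κ-~)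
      code-injective κ-~ κ-inj {x} {y} eq =
        κ-inj (trans (sym (dart-code κ-~ x)) (trans (cong dart eq) (dart-code κ-~ y)))

    -- Two charges per index are compared with two darts per edge, and the common factor 2 cancels.
    charge⇒≤ : (∀ x → uncurry _~_ (κ x)) → Injective _≡_ _≡_ κ → m ≤ e G
    charge⇒≤ κ-~ κ-inj = ×-injective⇒≤ (code-injective κ-~ κ-inj)

    -- In the case of equality the induced map on `Fin m × Fin 2` is an injective self-map of a
    -- finite set, hence onto.
    charge⇒covers : (∀ x → uncurry _~_ (κ x)) → Injective _≡_ _≡_ κ → m ≡ e G →
                    ∀ {u v} → u ~ v → ∃ λ x → κ x ≡ (u , v)
    charge⇒covers κ-~ κ-inj refl u~v =
      let d , dart-d = dart-covers u~v
          x , code-x = ×-injective⇒covers (code-injective κ-~ κ-inj) d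
      in x , trans (sym (dart-code κ-~ x)) (trans (cong dart code-x) dart-d)

    covers⇒≥ : (∀ {u v} → u ~ v → ∃ λ x → κ x ≡ (u , v)) → e G ≤ m
    covers⇒≥ κ-covers = ×-injective⇒≤ pre-injective
      where
      pre : ∀ d → ∃ λ x → κ x ≡ dart d
      pre d = κ-covers (dart-~ d)

      pre-injective : Injective _≡_ _≡_ (proj₁ ∘ pre)
      pre-injective {c} {d} eq =
        dart-injective (trans (sym (proj₂ (pre c))) (trans (cong κ eq) (proj₂ (pre d))))

-- Copies of the forbidden graph as fans.

F : (q : ℕ) → Graph (1 + (2 + q * 1))
F q = K 1 ∨ (K 2 ∪ (q · K 1))

-- A copy of K₁ ∨ (K₂ ∪ qK₁), given by the images of its parts.
record Fan (q : ℕ) (H : Graph n) : Set where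
  open Graph H
  field
    hub base₁ base₂ : Fin n
    pendant         : Fin (q * 1) → Fin n
    hub~base₁       : hub ~ base₁
    hub~base₂       : hub ~ base₂
    base₁~base₂     : base₁ ~ base₂
    hub~pendant     : ∀ i → hub ~ pendant i
    pendant-inj     : Injective _≡_ _≡_ pendant
    pendant≢base₁   : ∀ i → pendant i ≢ base₁
    pendant≢base₂   : ∀ i → pendant i ≢ base₂

edgeless : ∀ a {u v} → ¬ Graph._~_ (a · K 1) u v
edgeless (suc a) {zero}  {zero}  (inj₁ 0≢0) = 0≢0 refl
edgeless (suc a) {suc u} {suc v} (inj₂ u~v) = edgeless a u~v

⊑⇒fan : {H : Graph n} → F q ⊑ H → Fan q H
⊑⇒fan (f , f-inj , hom) = record
  { hub = f 0F ; base₁ = f 1F ; base₂ = f 2F ; pendant = λ i → f (suc (suc (suc i)))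
  ; hub~base₁     = hom {0F} {1F} tt
  ; hub~base₂     = hom {0F} {2F} tt
  ; base₁~base₂   = hom {1F} {2F} (inj₁ λ ())
  ; hub~pendant   = λ i → hom {0F} {suc (suc (suc i))} tt
  ; pendant-inj   = λ eq → Fin.suc-injective (Fin.suc-injective (Fin.suc-injective (f-inj eq)))
  ; pendant≢base₁ = λ i eq → contradiction (f-inj eq) λ ()
  ; pendant≢base₂ = λ i eq → contradiction (f-inj eq) λ ()
  }

fan⇒⊑ : {H : Graph n} → Fan q H → F q ⊑ H
fan⇒⊑ {n} {q} {H} fan = f , (λ {i} {j} → inj i j) , (λ {i} {j} → hom i j)
  where
  open Fan fan
  open Graph H

  ~⇒≢ : ∀ {u v} → u ~ v → u ≢ v
  ~⇒≢ u~v u≡v = ~-irrefl u≡v u~v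

  f : Fin (1 + (2 + q * 1)) → Fin n
  f 0F                  = hub
  f 1F                  = base₁
  f 2F                  = base₂
  f (suc (suc (suc i))) = pendant i

  -- Adjacent vertices are distinct; only a pendant against a base vertex or another pendant needs
  -- the distinctness fields of the fan.
  inj : ∀ i j → f i ≡ f j → i ≡ j
  inj 0F 0F eq = refl
  inj 0F 1F eq = contradiction eq (~⇒≢ hub~base₁)
  inj 0F 2F eq = contradiction eq (~⇒≢ hub~base₂)
  inj 0F (suc (suc (suc j))) eq = contradiction eq (~⇒≢ (hub~pendant j))
  inj 1F 0F eq = contradiction (sym eq) (~⇒≢ hub~base₁)
  inj 1F 1F eq = refl
  inj 1F 2F eq = contradiction eq (~⇒≢ base₁~base₂)
  inj 1F (suc (suc (suc j))) eq = contradiction (sym eq) (pendant≢base₁ j)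
  inj 2F 0F eq = contradiction (sym eq) (~⇒≢ hub~base₂)
  inj 2F 1F eq = contradiction (sym eq) (~⇒≢ base₁~base₂)
  inj 2F 2F eq = refl
  inj 2F (suc (suc (suc j))) eq = contradiction (sym eq) (pendant≢base₂ j)
  inj (suc (suc (suc i))) 0F eq = contradiction (sym eq) (~⇒≢ (hub~pendant i))
  inj (suc (suc (suc i))) 1F eq = contradiction eq (pendant≢base₁ i)
  inj (suc (suc (suc i))) 2F eq = contradiction eq (pendant≢base₂ i)
  inj (suc (suc (suc i))) (suc (suc (suc j))) eq = cong (λ k → Fin.suc (Fin.suc (Fin.suc k))) (pendant-inj eq)

  hom : ∀ i j → Graph._~_ (F q) i j → f i ~ f j
  hom 0F 0F 0≢0 = contradiction refl 0≢0
  hom 0F 1F _ = hub~base₁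
  hom 0F 2F _ = hub~base₂
  hom 0F (suc (suc (suc j))) _ = hub~pendant j
  hom 1F 0F _ = ~-sym hub~base₁
  hom 1F 1F (inj₁ 0≢0) = contradiction refl 0≢0
  hom 1F 2F _ = base₁~base₂
  hom 2F 0F _ = ~-sym hub~base₂
  hom 2F 1F _ = ~-sym base₁~base₂
  hom 2F 2F (inj₁ 1≢1) = contradiction refl 1≢1
  hom (suc (suc (suc i))) 0F _ = ~-sym (hub~pendant i)
  hom (suc (suc (suc i))) (suc (suc (suc j))) (inj₂ i~j) = contradiction i~j (edgeless q)

-- Non-adjacent pairs in a saturated graph.

OnTriangle : Graph n → Fin n → Set
OnTriangle G v = ∃₂ λ y z → v ~ y × v ~ z × y ~ z
  where open Graph G

-- What remains in G of the copy of K₁ ∨ (K₂ ∪ qK₁) created by a new pendant edge.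
record Hub (q : ℕ) (G : Graph n) (v : Fin n) : Set where
  constructor mkHub
  open Graph G
  field
    {y z} : Fin n
    v~y   : v ~ y
    v~z   : v ~ z
    y~z   : y ~ z
    third : 2 ≤ q → ∃ λ w → v ~ w × w ≢ y × w ≢ z

hub⇒triangle : {G : Graph n} {v : Fin n} → Hub q G v → OnTriangle G v
hub⇒triangle (mkHub v~y v~z y~z _) = _ , _ , v~y , v~z , y~z

-- With q ≥ 2 some pendant edge differs from the added one and so survives in the original graph.
other : 2 ≤ q → (i : Fin (q * 1)) → ∃ λ j → j ≢ i
other (s≤s (s≤s _)) zero    = 1F , λ ()
other (s≤s (s≤s _)) (suc _) = 0F , λ ()

module _ {G : Graph n} (sat : Saturated (F q) G) where
  open Graph G

  module _ {u v : Fin n} (u≢v : u ≢ v) (u≁v : ¬ u ~ v) where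
    private
      open Graph (addEdge G u v u≢v) using ()
        renaming (_~_ to _~⁺_; ~-irrefl to ~⁺-irrefl; ~-sym to ~⁺-sym)

      New : Fin n → Fin n → Set
      New x y = (x ≡ u × y ≡ v) ⊎ (y ≡ u × x ≡ v)

      new? : ∀ x y → Dec (New x y)
      new? x y = ((x ≟ u) ×-dec (y ≟ v)) ⊎-dec ((y ≟ u) ×-dec (x ≟ v))

      old : ∀ {x y} → ¬ New x y → x ~⁺ y → x ~ y
      old _    (inj₁ x~y) = x~y
      old ¬new (inj₂ new) = contradiction new ¬new

      new-unique : ∀ {x y z} → New x y → New x z → y ≡ z
      new-unique (inj₁ (refl , refl)) (inj₁ (_ , refl))  = refl
      new-unique (inj₁ (refl , refl)) (inj₂ (_ , u≡v))   = contradiction u≡v u≢v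
      new-unique (inj₂ (refl , refl)) (inj₁ (v≡u , _))   = contradiction (sym v≡u) u≢v
      new-unique (inj₂ (refl , refl)) (inj₂ (refl , _))  = refl

      new-swap : ∀ {x y} → New x y → New y x
      new-swap (inj₁ (x≡u , y≡v)) = inj₂ (x≡u , y≡v)
      new-swap (inj₂ (y≡u , x≡v)) = inj₁ (y≡u , x≡v)

      -- Only one edge is new, so a triangle with a new side has two old sides, and these meet in a
      -- common neighbour of `u` and `v`.
      apex : ∀ {x y z} → New x y → x ~⁺ z → y ~⁺ z → ∃ λ w → u ~ w × v ~ w
      apex {x} {y} {z} new x~z y~z = go new
        where
        xz : x ~ z
        xz = old (λ new′ → ~⁺-irrefl (new-unique new new′) y~z) x~z
        yz : y ~ z
        yz = old (λ new′ → ~⁺-irrefl (new-unique (new-swap new) new′) x~z) y~z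
        go : New x y → ∃ λ w → u ~ w × v ~ w
        go (inj₁ (refl , refl)) = z , xz , yz
        go (inj₂ (refl , refl)) = z , yz , xz

      open Fan (⊑⇒fan {q = q} {H = addEdge G u v u≢v} (proj₂ sat u v (u≢v , u≁v)))

    -- The copy created by the edge `uv` must use it. As a side of the triangle it yields a common
    -- neighbour; as a pendant edge it makes `u` or `v` the hub, whose triangle is then old.
    saturated-pair : (∃ λ w → u ~ w × v ~ w) ⊎ (Hub q G u ⊎ Hub q G v)
    saturated-pair
      with new? hub base₁ | new? hub base₂ | new? base₁ base₂ | any? (λ i → new? hub (pendant i))
    ... | yes new | _ | _ | _ = inj₁ (apex new hub~base₂ base₁~base₂)
    ... | no _ | yes new | _ | _ = inj₁ (apex new hub~base₁ (~⁺-sym base₁~base₂))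
    ... | no _ | no _ | yes new | _ = inj₁ (apex new (~⁺-sym hub~base₁) (~⁺-sym hub~base₂))
    -- No edge of the copy is new, so the copy already lies in `G`.
    ... | no ¬new₁ | no ¬new₂ | no ¬new₃ | no ¬new = contradiction (fan⇒⊑ fan) (proj₁ sat)
      where
      fan : Fan q G
      fan = record
        { hub~base₁ = old ¬new₁ hub~base₁ ; hub~base₂ = old ¬new₂ hub~base₂
        ; base₁~base₂ = old ¬new₃ base₁~base₂
        ; hub~pendant = λ i → old (λ new → ¬new (i , new)) (hub~pendant i)
        ; pendant-inj = pendant-inj ; pendant≢base₁ = pendant≢base₁ ; pendant≢base₂ = pendant≢base₂ }
    ... | no ¬new₁ | no ¬new₂ | no ¬new₃ | yes (i , new) = inj₂ (place new)
      where
      third : 2 ≤ q → ∃ λ w → hub ~ w × w ≢ base₁ × w ≢ base₂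
      third 2≤q with other 2≤q i
      ... | j , j≢i = pendant j
                    , old (λ new′ → j≢i (pendant-inj (new-unique new′ new))) (hub~pendant j)
                    , pendant≢base₁ j , pendant≢base₂ j
      hub-hub : Hub q G hub
      hub-hub = mkHub (old ¬new₁ hub~base₁) (old ¬new₂ hub~base₂) (old ¬new₃ base₁~base₂) third
      place : New hub (pendant i) → Hub q G u ⊎ Hub q G v
      place (inj₁ (hub≡u , _)) = inj₁ (subst (Hub q G) hub≡u hub-hub)
      place (inj₂ (_ , hub≡v)) = inj₂ (subst (Hub q G) hub≡v hub-hub)

-- The charging scheme.

-- Each non-root vertex is charged with two darts: an inner vertex with both
-- orientations of the edge to its parent, an outer one with two darts leaving it.
module _ (G : Graph n) (r : Fin n) where
  open Graph G

  data Role (v : Fin n) : Set where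
    root  : v ≡ r → Role v
    inner : ∀ p → v ~ p → v ≢ r → p ≡ r ⊎ (r ~ p × ¬ r ~ v) → Role v
    outer : ∀ y z → v ~ y → v ~ z → y ≢ z → v ≢ r → ¬ r ~ v → Role v

module _ {G : Graph n} {r : Fin n} where
  open Graph G

  charge : ∀ {v} → Role G r v → Fin 2 → Fin n × Fin n
  -- A filler value that is no dart; the root is never charged.
  charge {v} (root _)              _  = v , v
  charge {v} (inner p _ _ _)       0F = v , p
  charge {v} (inner p _ _ _)       1F = p , v
  charge {v} (outer y _ _ _ _ _ _) 0F = v , y
  charge {v} (outer _ z _ _ _ _ _) 1F = v , z

  charge-~ : ∀ {v} (ρ : Role G r v) → v ≢ r → ∀ b → uncurry _~_ (charge ρ b)
  charge-~ (root v≡r)              v≢r _  = contradiction v≡r v≢r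
  charge-~ (inner _ v~p _ _)       _   0F = v~p
  charge-~ (inner _ v~p _ _)       _   1F = ~-sym v~p
  charge-~ (outer _ _ v~y _ _ _ _) _   0F = v~y
  charge-~ (outer _ _ _ v~z _ _ _) _   1F = v~z

  charge-injective : ∀ {v} (ρ : Role G r v) → v ≢ r → Injective _≡_ _≡_ (charge ρ)
  charge-injective (root v≡r) v≢r eq = contradiction v≡r v≢r
  charge-injective ρ v≢r {0F} {0F} eq = refl
  charge-injective ρ v≢r {1F} {1F} eq = refl
  charge-injective (inner p v~p _ _) v≢r {0F} {1F} eq = contradiction v~p (~-irrefl (cong proj₁ eq))
  charge-injective (inner p v~p _ _) v≢r {1F} {0F} eq = contradiction v~p (~-irrefl (cong proj₂ eq))
  charge-injective (outer _ _ _ _ y≢z _ _) v≢r {0F} {1F} eq = contradiction (cong proj₂ eq) y≢z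
  charge-injective (outer _ _ _ _ y≢z _ _) v≢r {1F} {0F} eq = contradiction (sym (cong proj₂ eq)) y≢z

  -- A parent is strictly nearer to the root than its child.
  no-mutual-parents : ∀ {v w} → v ≢ r → w ≢ r →
                      w ≡ r ⊎ (r ~ w × ¬ r ~ v) → ¬ (v ≡ r ⊎ (r ~ v × ¬ r ~ w))
  no-mutual-parents v≢r w≢r (inj₁ w≡r) _                = w≢r w≡r
  no-mutual-parents v≢r w≢r _          (inj₁ v≡r)       = v≢r v≡r
  no-mutual-parents v≢r w≢r (inj₂ (_ , r≁v)) (inj₂ (r~v , _)) = r≁v r~v

  -- Parents lie within distance 1 of the root, outer vertices do not.
  outer-not-parent : ∀ {v w} → v ≢ r → ¬ r ~ v → ¬ (v ≡ r ⊎ (r ~ v × ¬ r ~ w))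
  outer-not-parent v≢r r≁v (inj₁ v≡r)       = v≢r v≡r
  outer-not-parent v≢r r≁v (inj₂ (r~v , _)) = r≁v r~v

  -- Two outgoing charges differ in their tails and two reversed ones in their heads. An outgoing
  -- charge of one vertex that equals a reversed charge of another would make an outer vertex a
  -- parent, or two inner vertices parents of each other.
  charge-disjoint : ∀ {v w} (ρ : Role G r v) (σ : Role G r w) → v ≢ r → w ≢ r → v ≢ w →
                    ∀ b c → charge ρ b ≢ charge σ c
  charge-disjoint (root v≡r) _ v≢r _ _ _ _ _ = v≢r v≡r
  charge-disjoint _ (root w≡r) _ w≢r _ _ _ _ = w≢r w≡r
  charge-disjoint (inner _ _ _ _) (inner _ _ _ _) _ _ v≢w 0F 0F eq = v≢w (cong proj₁ eq)
  charge-disjoint (inner _ _ _ _) (inner _ _ _ _) _ _ v≢w 1F 1F eq = v≢w (cong proj₂ eq)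
  charge-disjoint (inner _ _ _ p) (inner _ _ _ p′) v≢r w≢r _ 0F 1F refl = no-mutual-parents v≢r w≢r p p′
  charge-disjoint (inner _ _ _ p) (inner _ _ _ p′) v≢r w≢r _ 1F 0F refl = no-mutual-parents v≢r w≢r p p′
  charge-disjoint (inner _ _ _ _) (outer _ _ _ _ _ _ _) _ _ v≢w 0F 0F eq = v≢w (cong proj₁ eq)
  charge-disjoint (inner _ _ _ _) (outer _ _ _ _ _ _ _) _ _ v≢w 0F 1F eq = v≢w (cong proj₁ eq)
  charge-disjoint (inner _ _ _ p) (outer _ _ _ _ _ _ r≁w) _ w≢r _ 1F 0F refl = outer-not-parent w≢r r≁w p
  charge-disjoint (inner _ _ _ p) (outer _ _ _ _ _ _ r≁w) _ w≢r _ 1F 1F refl = outer-not-parent w≢r r≁w p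
  charge-disjoint (outer _ _ _ _ _ _ _) (inner _ _ _ _) _ _ v≢w 0F 0F eq = v≢w (cong proj₁ eq)
  charge-disjoint (outer _ _ _ _ _ _ _) (inner _ _ _ _) _ _ v≢w 1F 0F eq = v≢w (cong proj₁ eq)
  charge-disjoint (outer _ _ _ _ _ _ r≁v) (inner _ _ _ p) v≢r _ _ 0F 1F refl = outer-not-parent v≢r r≁v p
  charge-disjoint (outer _ _ _ _ _ _ r≁v) (inner _ _ _ p) v≢r _ _ 1F 1F refl = outer-not-parent v≢r r≁v p
  charge-disjoint (outer _ _ _ _ _ _ _) (outer _ _ _ _ _ _ _) _ _ v≢w 0F 0F eq = v≢w (cong proj₁ eq)
  charge-disjoint (outer _ _ _ _ _ _ _) (outer _ _ _ _ _ _ _) _ _ v≢w 0F 1F eq = v≢w (cong proj₁ eq)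
  charge-disjoint (outer _ _ _ _ _ _ _) (outer _ _ _ _ _ _ _) _ _ v≢w 1F 0F eq = v≢w (cong proj₁ eq)
  charge-disjoint (outer _ _ _ _ _ _ _) (outer _ _ _ _ _ _ _) _ _ v≢w 1F 1F eq = v≢w (cong proj₁ eq)

module Charging {G : Graph (suc n)} {r : Fin (suc n)} (role : ∀ v → Role G r v) where
  open Graph G
  open Darts G

  κ : Fin n × Fin 2 → Fin (suc n) × Fin (suc n)
  κ (i , b) = charge (role (punchIn r i)) b

  κ-~ : ∀ x → uncurry _~_ (κ x)
  κ-~ (i , b) = charge-~ (role _) (punchInᵢ≢i r i) b

  κ-injective : Injective _≡_ _≡_ κ
  κ-injective {i , b} {j , c} eq with i ≟ j
  ... | yes refl = cong (i ,_) (charge-injective (role _) (punchInᵢ≢i r i) eq)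
  ... | no  i≢j  = contradiction eq
    (charge-disjoint (role _) (role _) (punchInᵢ≢i r i) (punchInᵢ≢i r j) (i≢j ∘ punchIn-injective r i j) b c)

  n≤e : n ≤ e G
  n≤e = charge⇒≤ κ κ-~ κ-injective

  -- The converse bound for graphs in which every dart is known to be charged; it serves to count
  -- the edges of the extremal graphs.
  e≤n : (∀ {u w} → u ~ w → ∃₂ λ v b → v ≢ r × charge (role v) b ≡ (u , w)) → e G ≤ n
  e≤n covers = covers⇒≥ κ λ u~w → go (covers u~w)
    where
    go : ∀ {d} → (∃₂ λ v b → v ≢ r × charge (role v) b ≡ d) → ∃ λ x → κ x ≡ d
    go (v , b , v≢r , eq) = (punchOut (v≢r ∘ sym) , b)
      , trans (cong (λ x → charge (role x) b) (punchIn-punchOut (v≢r ∘ sym))) eq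

  Parent Ends : ∀ {v} → Role G r v → Fin (suc n) → Set
  Parent (inner p _ _ _) w = p ≡ w
  Parent _               _ = ⊥
  Ends (outer y z _ _ _ _ _) w = w ≡ y ⊎ w ≡ z
  Ends _                     _ = ⊥

  -- Under equality every dart is charged, so it is a parent edge of its tail, a reversed parent
  -- edge of its head, or one of the two darts charged to an outer tail.
  owner : n ≡ e G → ∀ {u w} → u ~ w → Parent (role u) w ⊎ Parent (role w) u ⊎ Ends (role u) w
  owner n≡e u~w with charge⇒covers κ κ-~ κ-injective n≡e u~w
  ... | (i , b) , eq = go (punchInᵢ≢i r i) (role (punchIn r i)) refl b eq
    where
    go : ∀ {u w v} → v ≢ r → (ρ : Role G r v) → ρ ≡ role v → ∀ b → charge ρ b ≡ (u , w) →
         Parent (role u) w ⊎ Parent (role w) u ⊎ Ends (role u) w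
    go v≢r (root v≡r) _ _ _ = contradiction v≡r v≢r
    go _ (inner _ _ _ _) eq 0F refl rewrite sym eq = inj₁ refl
    go _ (inner _ _ _ _) eq 1F refl rewrite sym eq = inj₂ (inj₁ refl)
    go _ (outer _ _ _ _ _ _ _) eq 0F refl rewrite sym eq = inj₂ (inj₂ (inj₁ refl))
    go _ (outer _ _ _ _ _ _ _) eq 1F refl rewrite sym eq = inj₂ (inj₂ (inj₂ refl))

-- The shape of the extremal graphs.

IsolatedTriangle : Graph n → Fin n → Set
IsolatedTriangle G v = ∃₂ λ y z → v ~ y × v ~ z × y ~ z × (∀ {w} → v ~ w → w ≡ y ⊎ w ≡ z)
  where open Graph G

-- A purely local description, checkable vertex by vertex. `IsolatedTriangle` only says that a
-- vertex of a triangle has degree 2; a triangle is a component once all three of its vertices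
-- satisfy it. For q ≥ 1 the condition `¬ 2 ≤ q` means q = 1.
record StarWithTriangles (q : ℕ) (G : Graph n) (s : Fin n) : Set where
  open Graph G
  field
    leaf : ∀ {u v} → s ~ u → u ~ v → v ≡ s
    kind : ∀ v → v ≡ s ⊎ s ~ v ⊎ (IsolatedTriangle G v × ¬ 2 ≤ q)

-- Renames the at most two neighbours of a vertex to any two distinct neighbours already known.
two-values : ∀ {A : Set} {a b y z : A} → a ≢ b → a ≡ y ⊎ a ≡ z → b ≡ y ⊎ b ≡ z →
             ∀ {w} → w ≡ y ⊎ w ≡ z → w ≡ a ⊎ w ≡ b
two-values a≢b (inj₁ refl) (inj₁ refl) _ = contradiction refl a≢b
two-values a≢b (inj₂ refl) (inj₂ refl) _ = contradiction refl a≢b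
two-values a≢b (inj₁ refl) (inj₂ refl) w∈ = w∈
two-values a≢b (inj₂ refl) (inj₁ refl) w∈ = Sum.swap w∈

onTriangle? : (G : Graph n) (v : Fin n) → Dec (OnTriangle G v)
onTriangle? G v = any? λ y → any? λ z → (v ~? y) ×-dec (v ~? z) ×-dec (y ~? z)
  where open Graph G

-- The lower bound on the number of edges.

module _ {G : Graph (suc n)} (sat : Saturated (F q) G) where
  open Graph G

  private
    Root : Fin (suc n) → Set
    Root r = ¬ OnTriangle G r ⊎ (∀ v → OnTriangle G v)

    ~⇒≢ : ∀ {u v} → u ~ v → u ≢ v
    ~⇒≢ u~v u≡v = ~-irrefl u≡v u~v

  ∃-root : ∃ Root
  ∃-root with any? (λ v → ¬? (onTriangle? G v))
  ... | yes (r , r∉) = r , inj₁ r∉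
  ... | no  none     = 0F , inj₂ λ v → decidable-stable (onTriangle? G v) (λ v∉ → none (v , v∉))

  -- A vertex not adjacent to the root shares a neighbour with it, which becomes the parent, or one
  -- of the two is a hub. The choice of the root ensures that in the second case `v` lies on a
  -- triangle: either the root cannot be a hub, or every vertex is on a triangle.
  saturated-role : ∀ {r} → Root r → ∀ v → Role G r v
  saturated-role {r} r-root v with v ≟ r | r ~? v
  ... | yes v≡r | _       = root v≡r
  ... | no  v≢r | yes r~v = inner r (~-sym r~v) v≢r (inj₁ refl)
  ... | no  v≢r | no  r≁v = go r-root (saturated-pair {q = q} sat (v≢r ∘ sym) r≁v)
    where
    triangle⇒outer : OnTriangle G v → Role G r v
    triangle⇒outer (y , z , v~y , v~z , y~z) = outer y z v~y v~z (~⇒≢ y~z) v≢r r≁v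

    go : Root r → (∃ λ w → r ~ w × v ~ w) ⊎ (Hub q G r ⊎ Hub q G v) → Role G r v
    go _         (inj₁ (w , r~w , v~w)) = inner w v~w v≢r (inj₂ (r~w , r≁v))
    go (inj₁ r∉) (inj₂ (inj₁ r-hub))    = contradiction (hub⇒triangle r-hub) r∉
    go (inj₂ ∀∈) (inj₂ (inj₁ _))        = triangle⇒outer (∀∈ v)
    go _         (inj₂ (inj₂ v-hub))    = triangle⇒outer (hub⇒triangle v-hub)

  saturated⇒≥ : n ≤ e G
  saturated⇒≥ = Charging.n≤e (saturated-role (proj₂ ∃-root))

  -- The case of equality.

  module _ (tight : n ≡ e G) {r : Fin (suc n)} (role : ∀ v → Role G r v) where
    private
      open Charging role using (Parent; Ends)

      owner : ∀ {u w} → u ~ w → Parent (role u) w ⊎ Parent (role w) u ⊎ Ends (role u) w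
      owner = Charging.owner role tight

      parent-near : ∀ {w p} (ρ : Role G r w) → Parent ρ p → p ≡ r ⊎ r ~ p
      parent-near (inner _ _ _ near) refl = Sum.map₂ proj₁ near

      child-parent : ∀ {u p} → r ~ u → (ρ : Role G r u) → Parent ρ p → p ≡ r
      child-parent r~u (inner _ _ _ (inj₁ p≡r))       refl = p≡r
      child-parent r~u (inner _ _ _ (inj₂ (_ , r≁u))) refl = contradiction r~u r≁u

      child-ends : ∀ {u p} → r ~ u → (ρ : Role G r u) → ¬ Ends ρ p
      child-ends r~u (outer _ _ _ _ _ _ r≁u) _ = r≁u r~u

      -- The only parent of a child is the root, and a child is not outer, so an edge between two
      -- children would not be charged.
      children-nonadjacent : ∀ {x y} → r ~ x → r ~ y → ¬ x ~ y
      children-nonadjacent {x} {y} r~x r~y x~y with owner x~y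
      ... | inj₁ y-parent        = ~-irrefl (sym (child-parent r~x (role x) y-parent)) r~y
      ... | inj₂ (inj₁ x-parent) = ~-irrefl (sym (child-parent r~y (role y) x-parent)) r~x
      ... | inj₂ (inj₂ y-end)    = child-ends r~x (role x) y-end

      r∉triangle : ¬ OnTriangle G r
      r∉triangle (x , y , r~x , r~y , x~y) = children-nonadjacent r~x r~y x~y

      -- Refines `Role`: vertices at distance 2 from the root are now leaves, and outer vertices
      -- have no neighbour among the children.
      data Kind (v : Fin (suc n)) : Set where
        root       : v ≡ r → Kind v
        child      : r ~ v → Kind v
        grandchild : ∀ p → r ~ p → v ~ p → v ≢ r → ¬ r ~ v → (∀ {w} → v ~ w → w ≡ p) → Kind v
        far        : (∀ {p} → r ~ p → ¬ p ~ v) → IsolatedTriangle G v → ¬ 2 ≤ q → Kind v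

      kind-of : ∀ v → Kind v
      kind-of v with role v in role-v
      ... | root v≡r = root v≡r
      ... | inner p v~p _ (inj₁ refl) = child (~-sym v~p)
      ... | inner p v~p v≢r (inj₂ (r~p , r≁v)) = grandchild p r~p v~p v≢r r≁v only-p
        where
        -- At distance 2, `v` is neither outer nor a parent, so its own parent edge is the only one
        -- that can own a dart leaving it.
        only-p : ∀ {w} → v ~ w → w ≡ p
        only-p {w} v~w with owner v~w
        ... | inj₁ w-parent rewrite role-v = sym w-parent
        ... | inj₂ (inj₁ v-parent) = contradiction (parent-near (role w) v-parent) [ v≢r , r≁v ]′
        ... | inj₂ (inj₂ w-end) rewrite role-v = ⊥-elim w-end
      ... | outer y z v~y v~z y≢z v≢r r≁v = go (saturated-pair {q = q} sat (v≢r ∘ sym) r≁v)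
        where
        ends : ∀ {w} → v ~ w → w ≡ y ⊎ w ≡ z
        ends {w} v~w with owner v~w
        ... | inj₁ w-parent rewrite role-v = ⊥-elim w-parent
        ... | inj₂ (inj₁ v-parent) = contradiction (parent-near (role w) v-parent) [ v≢r , r≁v ]′
        ... | inj₂ (inj₂ w-end) rewrite role-v = w-end

        -- A dart from a child to `v` has no owner: the child has parent `r` and is not outer, and
        -- `v`, being outer, has no parent.
        v-far : ∀ {p} → r ~ p → ¬ p ~ v
        v-far {p} r~p p~v with owner p~v
        ... | inj₁ v-parent = v≢r (child-parent r~p (role p) v-parent)
        ... | inj₂ (inj₁ p-parent) rewrite role-v = p-parent
        ... | inj₂ (inj₂ v-end) = child-ends r~p (role p) v-end

        -- Saturation of the pair `r`, `v` leaves only the possibility that `v` is a hub. Its degree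
        -- is 2, so it has no third neighbour and q < 2.
        go : (∃ λ w → r ~ w × v ~ w) ⊎ (Hub q G r ⊎ Hub q G v) → Kind v
        go (inj₁ (w , r~w , v~w)) = contradiction (~-sym v~w) (v-far r~w)
        go (inj₂ (inj₁ r-hub))    = contradiction (hub⇒triangle r-hub) r∉triangle
        go (inj₂ (inj₂ (mkHub {a} {b} v~a v~b a~b third))) =
          far v-far (a , b , v~a , v~b , a~b , ends-ab) no-third
          where
          ends-ab : ∀ {w} → v ~ w → w ≡ a ⊎ w ≡ b
          ends-ab v~w = two-values (~⇒≢ a~b) (ends v~a) (ends v~b) (ends v~w)

          no-third : ¬ 2 ≤ q
          no-third 2≤q = let w , v~w , w≢a , w≢b = third 2≤q in [ w≢a , w≢b ]′ (ends-ab v~w)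

      Grandchild : Fin (suc n) → Fin (suc n) → Set
      Grandchild v p = v ≢ r × ¬ r ~ v × r ~ p × v ~ p

      grandchild? : Dec (∃₂ Grandchild)
      grandchild? = any? λ v → any? λ p → ¬? (v ≟ r) ×-dec ¬? (r ~? v) ×-dec (r ~? p) ×-dec (v ~? p)

      centred-at-root : ¬ ∃₂ Grandchild → StarWithTriangles q G r
      centred-at-root none = record { leaf = leaf ; kind = kind }
        where
        leaf : ∀ {u w} → r ~ u → u ~ w → w ≡ r
        leaf {u} {w} r~u u~w with kind-of w
        ... | root w≡r                      = w≡r
        ... | child r~w                     = contradiction u~w (children-nonadjacent r~u r~w)
        ... | grandchild p r~p w~p w≢r r≁w _ = contradiction (w , p , w≢r , r≁w , r~p , w~p) none
        ... | far w-far _ _                 = contradiction u~w (w-far r~u)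

        kind : ∀ v → v ≡ r ⊎ r ~ v ⊎ (IsolatedTriangle G v × ¬ 2 ≤ q)
        kind v with kind-of v
        ... | root v≡r                      = inj₁ v≡r
        ... | child r~v                     = inj₂ (inj₁ r~v)
        ... | grandchild p r~p v~p v≢r r≁v _ = contradiction (v , p , v≢r , r≁v , r~p , v~p) none
        ... | far _ iso q<2                 = inj₂ (inj₂ (iso , q<2))

      -- A grandchild v lies at distance 3 from every child of the root other than its
      -- own parent p, so p is the only child.
      centred-at-parent : ∀ {v p} → Grandchild v p → StarWithTriangles q G p
      centred-at-parent {v} {p} (v≢r , r≁v , r~p , v~p) = record { leaf = leaf ; kind = kind }
        where
        v-only : ∀ {w} → v ~ w → w ≡ p
        v-only v~w with kind-of v
        ... | root v≡r = contradiction v≡r v≢r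
        ... | child r~v = contradiction r~v r≁v
        ... | grandchild _ _ _ _ _ only = trans (only v~w) (sym (only v~p))
        ... | far v-far _ _ = contradiction (~-sym v~p) (v-far r~p)

        v∉triangle : ¬ OnTriangle G v
        v∉triangle (a , b , v~a , v~b , a~b) = ~⇒≢ a~b (trans (v-only v~a) (sym (v-only v~b)))

        beyond-child : ∀ {x a} → r ~ x → x ~ a → a ≡ r ⊎ (∀ {w} → a ~ w → w ≡ x)
        beyond-child {x} {a} r~x x~a with kind-of a
        ... | root a≡r = inj₁ a≡r
        ... | child r~a = contradiction x~a (children-nonadjacent r~x r~a)
        ... | grandchild _ _ _ _ _ only = inj₂ λ a~w → trans (only a~w) (sym (only (~-sym x~a)))
        ... | far a-far _ _ = contradiction x~a (a-far r~x)

        child∉triangle : ∀ {x} → r ~ x → ¬ OnTriangle G x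
        child∉triangle r~x (a , b , x~a , x~b , a~b) with beyond-child r~x x~a
        ... | inj₁ refl = children-nonadjacent r~x a~b x~b
        ... | inj₂ only = ~-irrefl (sym (only a~b)) x~b

        only-child : ∀ {x} → r ~ x → x ≡ p
        -- Another child `x` would have no common neighbour with `v`, since `p` is the only
        -- neighbour of `v`; and neither `x` nor `v` is on a triangle, against saturation.
        only-child {x} r~x = decidable-stable (x ≟ p) λ x≢p →
          [ (λ (w , x~w , v~w) → children-nonadjacent r~x r~p (subst (x ~_) (v-only v~w) x~w))
          , [ child∉triangle r~x ∘ hub⇒triangle {G = G} {v = x} , v∉triangle ∘ hub⇒triangle ]′
          ]′ (saturated-pair {q = q} sat (λ { refl → r≁v r~x }) (λ x~v → x≢p (v-only (~-sym x~v))))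

        leaf : ∀ {u w} → p ~ u → u ~ w → w ≡ p
        leaf {u} p~u u~w with kind-of u
        ... | root refl = only-child u~w
        ... | child r~u = contradiction p~u (children-nonadjacent r~p r~u)
        ... | grandchild _ _ _ _ _ only = trans (only u~w) (sym (only (~-sym p~u)))
        ... | far u-far _ _ = contradiction p~u (u-far r~p)

        kind : ∀ u → u ≡ p ⊎ p ~ u ⊎ (IsolatedTriangle G u × ¬ 2 ≤ q)
        kind u with kind-of u
        ... | root refl = inj₂ (inj₁ (~-sym r~p))
        ... | child r~u = inj₁ (only-child r~u)
        ... | grandchild p′ r~p′ u~p′ _ _ _ = inj₂ (inj₁ (subst (_~ u) (only-child r~p′) (~-sym u~p′)))
        ... | far _ iso q<2 = inj₂ (inj₂ (iso , q<2))

    charged⇒star : ∃ (StarWithTriangles q G)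
    charged⇒star with grandchild?
    ... | yes (v , p , vp) = p , centred-at-parent vp
    ... | no  none         = r , centred-at-root none

  tight⇒star : n ≡ e G → ∃ (StarWithTriangles q G)
  tight⇒star tight = charged⇒star tight (saturated-role (proj₂ ∃-root))

-- Edge count of a star with triangles.

module _ {G : Graph (suc n)} {s : Fin (suc n)} (star : StarWithTriangles q G s) where
  open Graph G
  open StarWithTriangles star

  center-not-adjacent : ∀ {v} → IsolatedTriangle G v → ¬ s ~ v
  center-not-adjacent (y , z , v~y , v~z , y~z , _) s~v =
    ~-irrefl (trans (leaf s~v v~y) (sym (leaf s~v v~z))) y~z

  star-role : ∀ v → Role G s v
  star-role v with v ≟ s
  ... | yes v≡s = root v≡s
  ... | no  v≢s with kind v
  ... | inj₁ v≡s        = contradiction v≡s v≢s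
  ... | inj₂ (inj₁ s~v) = inner s (~-sym s~v) v≢s (inj₁ refl)
  ... | inj₂ (inj₂ (iso@(y , z , v~y , v~z , y~z , _) , _)) =
    outer y z v~y v~z (λ y≡z → ~-irrefl y≡z y~z) v≢s (center-not-adjacent iso)

  outward : ∀ {u w} → u ≢ s → u ~ w → ∃ λ b → charge (star-role u) b ≡ (u , w)
  outward {u} u≢s u~w with u ≟ s
  ... | yes u≡s = contradiction u≡s u≢s
  ... | no  _ with kind u
  ... | inj₁ u≡s        = contradiction u≡s u≢s
  ... | inj₂ (inj₁ s~u) = 0F , cong (u ,_) (sym (leaf s~u u~w))
  ... | inj₂ (inj₂ ((_ , _ , _ , _ , _ , only) , _)) with only u~w
  ...   | inj₁ w≡y = 0F , cong (u ,_) (sym w≡y)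
  ...   | inj₂ w≡z = 1F , cong (u ,_) (sym w≡z)

  inward : ∀ {w} → s ~ w → charge (star-role w) 1F ≡ (s , w)
  inward {w} s~w with w ≟ s
  ... | yes w≡s = contradiction s~w (~-irrefl (sym w≡s))
  ... | no  _ with kind w
  ... | inj₁ w≡s            = contradiction s~w (~-irrefl (sym w≡s))
  ... | inj₂ (inj₁ _)       = refl
  ... | inj₂ (inj₂ (iso , _)) = contradiction s~w (center-not-adjacent iso)

  -- The same charging, rooted at the centre, reaches every dart: those leaving the centre through
  -- their heads, all others through their tails.
  star⇒tight : e G ≡ n
  star⇒tight = ℕ.≤-antisym (Charging.e≤n star-role covers) (Charging.n≤e star-role)
    where
    covers : ∀ {u w} → u ~ w → ∃₂ λ v b → v ≢ s × charge (star-role v) b ≡ (u , w)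
    covers {u} {w} u~w with u ≟ s
    ... | yes refl = w , 1F , (λ w≡s → ~-irrefl (sym w≡s) u~w) , inward u~w
    ... | no  u≢s  = let b , eq = outward u≢s u~w in u , b , u≢s , eq

-- Saturation of a star with triangles, by its number of leaves.

record LeafEnumeration (G : Graph n) (s : Fin n) (m : ℕ) : Set where
  open Graph G
  field
    leafAt          : Fin m → Fin n
    leafAt-inj      : Injective _≡_ _≡_ leafAt
    center~leafAt   : ∀ i → s ~ leafAt i
    leafAt-covers   : ∀ {v} → s ~ v → ∃ λ i → leafAt i ≡ v

leafEnumeration : (G : Graph n) (s : Fin n) → ∃ (LeafEnumeration G s)
leafEnumeration {n} G s = length leaves , record
  { leafAt        = lookup leaves
  ; leafAt-inj    = lookup-injective (filter⁺ (s ~?_) (allFin⁺ n))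
  ; center~leafAt = λ i → proj₂ (∈-filter⁻ (s ~?_) {xs = allFin n} (∈-lookup i))
  ; leafAt-covers = λ s~v → let v∈ = ∈-filter⁺ (s ~?_) (∈-allFin _) s~v in index v∈ , sym (lookup-index v∈)
  }
  where
  open Graph G
  leaves = filter (s ~?_) (allFin n)

-- Skips `i`, then the position that `j` has among the remaining indices.
avoid₂ : {i j : Fin m} → i ≢ j → 2 + k ≤ m →
         ∃ λ (f : Fin k → Fin m) → Injective _≡_ _≡_ f × (∀ x → f x ≢ i × f x ≢ j)
avoid₂ {suc (suc m)} {k} {i} {j} i≢j (s≤s (s≤s k≤m)) = f , f-inj , λ x → punchInᵢ≢i i _ , f≢j x
  where
  f : Fin k → Fin (suc (suc m))
  f x = punchIn i (punchIn (punchOut i≢j) (inject≤ x k≤m))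

  f-inj : Injective _≡_ _≡_ f
  f-inj eq = Fin.inject≤-injective k≤m k≤m _ _
    (punchIn-injective (punchOut i≢j) _ _ (punchIn-injective i _ _ eq))

  f≢j : ∀ x → f x ≢ j
  f≢j x eq = punchInᵢ≢i (punchOut i≢j) _
    (punchIn-injective i _ _ (trans eq (sym (punchIn-punchOut i≢j))))

-- The two base vertices and the first pendant are three distinct neighbours of the hub.
fan-hub-wide : {H : Graph n} (fan : Fan q H) → 1 ≤ q →
               ∀ {y z} → ¬ (∀ {w} → Graph._~_ H (Fan.hub fan) w → w ≡ y ⊎ w ≡ z)
fan-hub-wide {H = H} fan (s≤s _) narrow =
  [ pendant≢base₁ 0F , pendant≢base₂ 0F ]′
    (two-values (λ eq → ~-irrefl eq base₁~base₂) (narrow hub~base₁) (narrow hub~base₂) (narrow (hub~pendant 0F)))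
  where
  open Graph H
  open Fan fan

module _ {G : Graph (suc n)} {s : Fin (suc n)} (star : StarWithTriangles q G s) (1≤q : 1 ≤ q) where
  open Graph G
  open StarWithTriangles star

  -- A hub lies on a triangle and has three neighbours. The centre and the leaves are on no
  -- triangle, and all other vertices have degree 2.
  star-free : ¬ (F q ⊑ G)
  star-free F⊑G with ⊑⇒fan {q = q} {H = G} F⊑G
  ... | fan with kind (Fan.hub fan)
  ...   | inj₁ refl = ~-irrefl (sym (leaf hub~base₁ base₁~base₂)) hub~base₂
    where open Fan fan
  ...   | inj₂ (inj₁ s~hub) = ~-irrefl (trans (leaf s~hub hub~base₁) (sym (leaf s~hub hub~base₂))) base₁~base₂
    where open Fan fan
  ...   | inj₂ (inj₂ ((_ , _ , _ , _ , _ , only) , _)) = fan-hub-wide fan 1≤q only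

  -- Joining the only two leaves turns the star into a triangle. Every vertex then has degree at
  -- most 2, too small for a hub.
  two-leaves⇒¬saturated : LeafEnumeration G s 2 → ¬ Saturated (F q) G
  two-leaves⇒¬saturated leaves (_ , sat) = narrow (kind hub)
    where
    open LeafEnumeration leaves
    u v : Fin (suc n)
    u = leafAt 0F
    v = leafAt 1F

    s~u : s ~ u
    s~u = center~leafAt 0F

    s~v : s ~ v
    s~v = center~leafAt 1F

    u≢v : u ≢ v
    u≢v u≡v = contradiction (leafAt-inj u≡v) λ ()

    u≁v : ¬ u ~ v
    u≁v u~v = ~-irrefl (sym (leaf s~u u~v)) s~v

    fan : Fan q (addEdge G u v u≢v)
    fan = ⊑⇒fan {q = q} {H = addEdge G u v u≢v} (sat u v (u≢v , u≁v))

    open Fan fan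
    open Graph (addEdge G u v u≢v) using () renaming (_~_ to _~⁺_)

    hub-wide : ∀ {y z} → ¬ (∀ {w} → hub ~⁺ w → w ≡ y ⊎ w ≡ z)
    hub-wide = fan-hub-wide fan 1≤q

    s-nbrs : ∀ {w} → s ~⁺ w → w ≡ u ⊎ w ≡ v
    s-nbrs (inj₁ s~w) with leafAt-covers s~w
    ... | 0F , refl = inj₁ refl
    ... | 1F , refl = inj₂ refl
    s-nbrs (inj₂ (inj₁ (s≡u , _))) = contradiction s~u (~-irrefl s≡u)
    s-nbrs (inj₂ (inj₂ (_ , s≡v))) = contradiction s~v (~-irrefl s≡v)

    u-nbrs : ∀ {w} → u ~⁺ w → w ≡ s ⊎ w ≡ v
    u-nbrs (inj₁ u~w)              = inj₁ (leaf s~u u~w)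
    u-nbrs (inj₂ (inj₁ (_ , w≡v))) = inj₂ w≡v
    u-nbrs (inj₂ (inj₂ (_ , u≡v))) = contradiction u≡v u≢v

    v-nbrs : ∀ {w} → v ~⁺ w → w ≡ s ⊎ w ≡ u
    v-nbrs (inj₁ v~w)              = inj₁ (leaf s~v v~w)
    v-nbrs (inj₂ (inj₁ (v≡u , _))) = contradiction (sym v≡u) u≢v
    v-nbrs (inj₂ (inj₂ (w≡u , _))) = inj₂ w≡u

    narrow : ¬ (hub ≡ s ⊎ s ~ hub ⊎ (IsolatedTriangle G hub × ¬ 2 ≤ q))
    narrow (inj₁ hub≡s) = hub-wide (λ {w} → s-nbrs ∘ subst (_~⁺ w) hub≡s)
    narrow (inj₂ (inj₁ s~hub)) with leafAt-covers s~hub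
    ... | 0F , u≡hub = hub-wide (λ {w} → u-nbrs ∘ subst (_~⁺ w) (sym u≡hub))
    ... | 1F , v≡hub = hub-wide (λ {w} → v-nbrs ∘ subst (_~⁺ w) (sym v≡hub))
    narrow (inj₂ (inj₂ (iso@(_ , _ , _ , _ , _ , only) , _))) = hub-wide λ where
      (inj₁ hub~w)              → only hub~w
      (inj₂ (inj₁ (hub≡u , _))) → contradiction (subst (s ~_) (sym hub≡u) s~u) (center-not-adjacent star iso)
      (inj₂ (inj₂ (_ , hub≡v))) → contradiction (subst (s ~_) (sym hub≡v) s~v) (center-not-adjacent star iso)

  star-saturated : LeafEnumeration G s m → ((i j : Fin m) → i ≢ j → 2 + q * 1 ≤ m) → Saturated (F q) G
  star-saturated {m} leaves room = star-free , λ u v (u≢v , u≁v) → fan⇒⊑ (fan-through u≢v u≁v (kind u) (kind v))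
    where
    open LeafEnumeration leaves

    single-pendant : ∀ q → ¬ 2 ≤ q → (i j : Fin (q * 1)) → i ≡ j
    single-pendant 1 _ 0F 0F = refl
    single-pendant (suc (suc _)) q<2 = contradiction (s≤s (s≤s z≤n)) q<2

    triangle-fan : {H : Graph (suc n)} → (∀ {x y} → x ~ y → Graph._~_ H x y) →
                   ∀ {u v} → IsolatedTriangle G u × ¬ 2 ≤ q →
                   ¬ u ~ v → Graph._~_ H u v → Fan q H
    triangle-fan sub {u} {v} ((y , z , u~y , u~z , y~z , _) , q<2) u≁v u~⁺v = record
      { hub~base₁ = sub u~y ; hub~base₂ = sub u~z ; base₁~base₂ = sub y~z
      ; pendant = λ _ → v ; hub~pendant = λ _ → u~⁺v
      ; pendant-inj = λ _ → single-pendant q q<2 _ _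
      ; pendant≢base₁ = λ { _ refl → u≁v u~y } ; pendant≢base₂ = λ { _ refl → u≁v u~z } }

    fan-through : ∀ {u v} (u≢v : u ≢ v) → ¬ u ~ v →
                  u ≡ s ⊎ s ~ u ⊎ (IsolatedTriangle G u × ¬ 2 ≤ q) →
                  v ≡ s ⊎ s ~ v ⊎ (IsolatedTriangle G v × ¬ 2 ≤ q) →
                  Fan q (addEdge G u v u≢v)
    fan-through u≢v u≁v (inj₂ (inj₂ tri)) _ =
      triangle-fan {H = addEdge G _ _ u≢v} inj₁ tri u≁v (inj₂ (inj₁ (refl , refl)))
    fan-through u≢v u≁v _ (inj₂ (inj₂ tri)) =
      triangle-fan {H = addEdge G _ _ u≢v} inj₁ tri (u≁v ∘ ~-sym) (inj₂ (inj₂ (refl , refl)))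
    fan-through u≢v u≁v (inj₁ refl) (inj₁ refl)       = contradiction refl u≢v
    fan-through u≢v u≁v (inj₁ refl) (inj₂ (inj₁ s~v)) = contradiction s~v u≁v
    fan-through u≢v u≁v (inj₂ (inj₁ s~u)) (inj₁ refl) = contradiction (~-sym s~u) u≁v
    fan-through u≢v u≁v (inj₂ (inj₁ s~u)) (inj₂ (inj₁ s~v))
      with i , refl ← leafAt-covers s~u | j , refl ← leafAt-covers s~v
      with f , f-inj , f-avoids ← avoid₂ (u≢v ∘ cong leafAt) (room i j (u≢v ∘ cong leafAt)) = record
      { hub~base₁ = inj₁ s~u ; hub~base₂ = inj₁ s~v ; base₁~base₂ = inj₂ (inj₁ (refl , refl))
      ; pendant = leafAt ∘ f ; hub~pendant = λ x → inj₁ (center~leafAt (f x))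
      ; pendant-inj = f-inj ∘ leafAt-inj
      ; pendant≢base₁ = λ x → proj₁ (f-avoids x) ∘ leafAt-inj
      ; pendant≢base₂ = λ x → proj₂ (f-avoids x) ∘ leafAt-inj }

-- Disjoint unions, and the model graphs built from them.

module _ (A : Graph k) (B : Graph n) where
  open Graph (A ∪ B)

  ∪-injˡ : ∀ {i j} → Graph._~_ A i j → (i ↑ˡ n) ~ (j ↑ˡ n)
  ∪-injˡ {i} {j} i~j rewrite Fin.splitAt-↑ˡ k i n | Fin.splitAt-↑ˡ k j n = inj₁ i~j

  ∪-injʳ : ∀ {i j} → Graph._~_ B i j → (k ↑ʳ i) ~ (k ↑ʳ j)
  ∪-injʳ {i} {j} i~j rewrite Fin.splitAt-↑ʳ k n i | Fin.splitAt-↑ʳ k n j = inj₂ i~j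

  ∪-view : ∀ v → (∃ λ i → i ↑ˡ n ≡ v) ⊎ (∃ λ j → k ↑ʳ j ≡ v)
  ∪-view v with splitAt k v | Fin.join-splitAt k n v
  ... | inj₁ i | eq = inj₁ (i , eq)
  ... | inj₂ j | eq = inj₂ (j , eq)

  ∪-nbrˡ : ∀ {i v} → (i ↑ˡ n) ~ v → ∃ λ j → j ↑ˡ n ≡ v × Graph._~_ A i j
  ∪-nbrˡ {i} {v} i~v with splitAt k v | Fin.join-splitAt k n v
  ... | x | eq rewrite Fin.splitAt-↑ˡ k i n with i~v
  ...   | inj₁ i~j = _ , eq , i~j

  ∪-nbrʳ : ∀ {i v} → (k ↑ʳ i) ~ v → ∃ λ j → k ↑ʳ j ≡ v × Graph._~_ B i j
  ∪-nbrʳ {i} {v} i~v with splitAt k v | Fin.join-splitAt k n v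
  ... | x | eq rewrite Fin.splitAt-↑ʳ k n i with i~v
  ...   | inj₂ i~j = _ , eq , i~j

  triangle-∪ˡ : ∀ {i} → IsolatedTriangle A i → IsolatedTriangle (A ∪ B) (i ↑ˡ n)
  triangle-∪ˡ (y , z , i~y , i~z , y~z , only) =
    y ↑ˡ n , z ↑ˡ n , ∪-injˡ i~y , ∪-injˡ i~z , ∪-injˡ y~z , λ i~w →
      let j , eq , i~j = ∪-nbrˡ i~w in
      Sum.map (λ j≡y → trans (sym eq) (cong (_↑ˡ n) j≡y)) (λ j≡z → trans (sym eq) (cong (_↑ˡ n) j≡z)) (only i~j)

  triangle-∪ʳ : ∀ {i} → IsolatedTriangle B i → IsolatedTriangle (A ∪ B) (k ↑ʳ i)
  triangle-∪ʳ (y , z , i~y , i~z , y~z , only) =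
    k ↑ʳ y , k ↑ʳ z , ∪-injʳ i~y , ∪-injʳ i~z , ∪-injʳ y~z , λ i~w →
      let j , eq , i~j = ∪-nbrʳ i~w in
      Sum.map (λ j≡y → trans (sym eq) (cong (k ↑ʳ_) j≡y)) (λ j≡z → trans (sym eq) (cong (k ↑ʳ_) j≡z)) (only i~j)

  star-∪ : ∀ {s} → (∀ i → IsolatedTriangle A i × ¬ 2 ≤ q) → StarWithTriangles q B s →
           StarWithTriangles q (A ∪ B) (k ↑ʳ s)
  star-∪ {q} {s} triangles star = record
    { leaf = λ s~u u~v → leaf′ (∪-nbrʳ s~u) u~v
    ; kind = λ v → kind′ (∪-view v) }
    where
    open StarWithTriangles star
    leaf′ : ∀ {u v} → (∃ λ i → k ↑ʳ i ≡ u × Graph._~_ B s i) → u ~ v → v ≡ k ↑ʳ s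
    leaf′ (i , refl , s~i) u~v = let j , eq , i~j = ∪-nbrʳ u~v in trans (sym eq) (cong (k ↑ʳ_) (leaf s~i i~j))
    kind′ : ∀ {v} → (∃ λ i → i ↑ˡ n ≡ v) ⊎ (∃ λ j → k ↑ʳ j ≡ v) →
            v ≡ k ↑ʳ s ⊎ (k ↑ʳ s) ~ v ⊎ (IsolatedTriangle (A ∪ B) v × ¬ 2 ≤ q)
    kind′ (inj₁ (i , refl)) = let tri , q<2 = triangles i in inj₂ (inj₂ (triangle-∪ˡ tri , q<2))
    kind′ (inj₂ (j , refl)) =
      Sum.map (cong (k ↑ʳ_)) (Sum.map ∪-injʳ (λ (tri , q<2) → triangle-∪ʳ tri , q<2)) (kind j)

  leaves-∪ : ∀ {s} → LeafEnumeration B s m → LeafEnumeration (A ∪ B) (k ↑ʳ s) m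
  leaves-∪ leaves = record
    { leafAt = λ i → k ↑ʳ leafAt i
    ; leafAt-inj = leafAt-inj ∘ Fin.↑ʳ-injective k _ _
    ; center~leafAt = ∪-injʳ ∘ center~leafAt
    ; leafAt-covers = λ s~v → let j , eq , s~j = ∪-nbrʳ s~v ; i , eq′ = leafAt-covers s~j
                              in i , trans (cong (k ↑ʳ_) eq′) eq }
    where open LeafEnumeration leaves

triangle-K₃ : ∀ i → IsolatedTriangle (K 3) i
triangle-K₃ 0F = 1F , 2F , (λ ()) , (λ ()) , (λ ()) , λ
  { {0F} 0≢0 → contradiction refl 0≢0
  ; {1F} _   → inj₁ refl
  ; {2F} _   → inj₂ refl }
triangle-K₃ 1F = 0F , 2F , (λ ()) , (λ ()) , (λ ()) , λ
  { {0F} _   → inj₁ refl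
  ; {1F} 1≢1 → contradiction refl 1≢1
  ; {2F} _   → inj₂ refl }
triangle-K₃ 2F = 0F , 1F , (λ ()) , (λ ()) , (λ ()) , λ
  { {0F} _   → inj₁ refl
  ; {1F} _   → inj₂ refl
  ; {2F} 2≢2 → contradiction refl 2≢2 }

triangle-aK₃ : ∀ a i → IsolatedTriangle (a · K 3) i
triangle-aK₃ (suc a) i with ∪-view (K 3) (a · K 3) i
... | inj₁ (j , refl) = triangle-∪ˡ (K 3) (a · K 3) (triangle-K₃ j)
... | inj₂ (j , refl) = triangle-∪ʳ (K 3) (a · K 3) (triangle-aK₃ a j)

star-S : StarWithTriangles q (S (suc m)) 0F
star-S = record { leaf = λ { {suc u} {0F} _ _ → refl } ; kind = λ { 0F → inj₁ refl ; (suc v) → inj₂ (inj₁ tt) } }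

leaves-S : LeafEnumeration (S (suc m)) 0F m
leaves-S = record { leafAt = suc ; leafAt-inj = Fin.suc-injective ; center~leafAt = λ _ → tt
                  ; leafAt-covers = λ { {suc v} _ → v , refl } }

-- Transport along isomorphisms.

module _ {G : Graph n} {H : Graph m} (iso : G ≅ H) where
  private
    φ-~ = proj₂ iso
    open Inverse (proj₁ iso) using (to; from; strictlyInverseˡ; strictlyInverseʳ)
    module G = Graph G
    module H = Graph H

  ≅-push : ∀ {x v} → from x G.~ v → x H.~ to v
  ≅-push {x} x~v = subst (H._~ _) (strictlyInverseˡ x) (Equivalence.to (φ-~ _ _) x~v)

  ≅-pull : ∀ {u y} → to u H.~ y → u G.~ from y
  ≅-pull {y = y} u~y = Equivalence.from (φ-~ _ _) (subst (_ H.~_) (sym (strictlyInverseˡ y)) u~y)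

  ≅-pull₂ : ∀ {x y} → x H.~ y → from x G.~ from y
  ≅-pull₂ {x} x~y = ≅-pull (subst (H._~ _) (sym (strictlyInverseˡ x)) x~y)

  to⇒from : ∀ {v x} → to v ≡ x → v ≡ from x
  to⇒from {v} eq = trans (sym (strictlyInverseʳ v)) (cong from eq)

  triangle-≅ : ∀ {v} → IsolatedTriangle H (to v) → IsolatedTriangle G v
  triangle-≅ (y , z , v~y , v~z , y~z , only) =
    from y , from z , ≅-pull v~y , ≅-pull v~z , ≅-pull₂ y~z ,
    λ v~w → Sum.map to⇒from to⇒from (only (Equivalence.to (φ-~ _ _) v~w))

  star-≅ : ∀ {s} → StarWithTriangles q H s → StarWithTriangles q G (from s)
  star-≅ {s = s} star = record
    { leaf = λ s~u u~v → to⇒from (leaf (≅-push s~u) (Equivalence.to (φ-~ _ _) u~v))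
    ; kind = λ v → Sum.map to⇒from
        (Sum.map (λ s~v → subst (from s G.~_) (strictlyInverseʳ v) (≅-pull₂ s~v))
                 (λ (tri , q<2) → triangle-≅ tri , q<2)) (kind (to v)) }
    where open StarWithTriangles star

  leaves-≅ : ∀ {s} → LeafEnumeration H s k → LeafEnumeration G (from s) k
  leaves-≅ leaves = record
    { leafAt = from ∘ leafAt
    ; leafAt-inj = λ {i} {j} eq → leafAt-inj
        (trans (sym (strictlyInverseˡ _)) (trans (cong to eq) (strictlyInverseˡ _)))
    ; center~leafAt = ≅-pull₂ ∘ center~leafAt
    ; leafAt-covers = λ s~v → let i , eq = leafAt-covers (≅-push s~v) in i , sym (to⇒from (sym eq)) }
    where open LeafEnumeration leaves

-- Associativity of the union with a leading triangle.

splitAt-injective : ∀ k {i j : Fin (k + n)} → splitAt k i ≡ splitAt k j → i ≡ j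
splitAt-injective {n} k {i} {j} eq =
  trans (sym (Fin.join-splitAt k n i)) (trans (cong (Fin.join k n) eq) (Fin.join-splitAt k n j))

module _ (A : Graph k) (B : Graph n) where
  private
    module L = Graph ((K 3 ∪ A) ∪ B)
    module R = Graph (K 3 ∪ (A ∪ B))

    _≈_ : Fin 3 ⊎ (Fin k ⊎ Fin n) → Fin 3 ⊎ (Fin k ⊎ Fin n) → Set
    _≈_ = Pointwise _≢_ (Pointwise (Graph._~_ A) (Graph._~_ B))

    splitˡ : Fin (3 + k) ⊎ Fin n → Fin 3 ⊎ (Fin k ⊎ Fin n)
    splitˡ = assocʳ ∘ Sum.map₁ (splitAt 3)

    splitʳ : Fin 3 ⊎ Fin (k + n) → Fin 3 ⊎ (Fin k ⊎ Fin n)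
    splitʳ = Sum.map₂ (splitAt k)

    splits-agree : (i : Fin (3 + (k + n))) → splitˡ (splitAt (3 + k) i) ≡ splitʳ (splitAt 3 i)
    splits-agree 0F = refl
    splits-agree 1F = refl
    splits-agree 2F = refl
    splits-agree (suc (suc (suc i))) with splitAt k i
    ... | inj₁ _ = refl
    ... | inj₂ _ = refl

    splitˡ-to : ∀ x y → Pointwise (Graph._~_ (K 3 ∪ A)) (Graph._~_ B) x y → splitˡ x ≈ splitˡ y
    splitˡ-to (inj₁ u) (inj₁ v) (inj₁ u~v) with splitAt 3 u | splitAt 3 v | u~v
    ... | inj₁ _ | inj₁ _ | inj₁ p = inj₁ p
    ... | inj₂ _ | inj₂ _ | inj₂ p = inj₂ (inj₁ p)
    splitˡ-to (inj₂ _) (inj₂ _) (inj₂ p) = inj₂ (inj₂ p)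

    splitˡ-from : ∀ x y → splitˡ x ≈ splitˡ y → Pointwise (Graph._~_ (K 3 ∪ A)) (Graph._~_ B) x y
    splitˡ-from (inj₁ u) (inj₁ v) u~v = inj₁ (go (splitAt 3 u) (splitAt 3 v) u~v)
      where
      go : ∀ x y → assocʳ (inj₁ x) ≈ assocʳ (inj₁ y) → Pointwise _≢_ (Graph._~_ A) x y
      go (inj₁ _) (inj₁ _) (inj₁ p)        = inj₁ p
      go (inj₂ _) (inj₂ _) (inj₂ (inj₁ p)) = inj₂ p
    splitˡ-from (inj₁ u) (inj₂ v) u~v with splitAt 3 u | u~v
    ... | inj₁ _ | ()
    ... | inj₂ _ | inj₂ ()
    splitˡ-from (inj₂ u) (inj₁ v) u~v with splitAt 3 v | u~v
    ... | inj₁ _ | ()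
    ... | inj₂ _ | inj₂ ()
    splitˡ-from (inj₂ _) (inj₂ _) (inj₂ (inj₂ p)) = inj₂ p

    splitʳ-to : ∀ x y → Pointwise _≢_ (Graph._~_ (A ∪ B)) x y → splitʳ x ≈ splitʳ y
    splitʳ-to (inj₁ _) (inj₁ _) (inj₁ p) = inj₁ p
    splitʳ-to (inj₂ _) (inj₂ _) (inj₂ p) = inj₂ p

    splitʳ-from : ∀ x y → splitʳ x ≈ splitʳ y → Pointwise _≢_ (Graph._~_ (A ∪ B)) x y
    splitʳ-from (inj₁ _) (inj₁ _) (inj₁ p) = inj₁ p
    splitʳ-from (inj₂ _) (inj₂ _) (inj₂ p) = inj₂ p

  -- Both orders compute to the same number, so the identity map serves as the isomorphism. The two
  -- adjacencies are compared on a threefold splitting of the vertices.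
  K₃∪-assoc : ∀ i j → i L.~ j ⇔ i R.~ j
  K₃∪-assoc i j = mk⇔
    (λ p → splitʳ-from _ _ (subst₂ _≈_ (splits-agree i) (splits-agree j) (splitˡ-to _ _ p)))
    (λ p → splitˡ-from (splitAt (3 + k) i) (splitAt (3 + k) j)
             (subst₂ _≈_ (sym (splits-agree i)) (sym (splits-agree j)) (splitʳ-to _ _ p)))

-- Components and the decomposition into triangles and a star.

-- An isomorphism of H onto a union of connected components of G.
record Component (H : Graph k) (G : Graph n) : Set where
  field
    at        : Fin k → Fin n
    at-inj    : Injective _≡_ _≡_ at
    at-~      : ∀ i j → Graph._~_ H i j ⇔ Graph._~_ G (at i) (at j)
    at-closed : ∀ {i v} → Graph._~_ G (at i) v → ∃ λ j → at j ≡ v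

-- Each image is closed under adjacency, so no edge joins the two disjoint images.
component-∪ : {A : Graph k} {B : Graph m} {G : Graph n}
              (α : Component A G) (β : Component B G) →
              (∀ i j → Component.at α i ≢ Component.at β j) → Component (A ∪ B) G
component-∪ {k} {m} {n} {A} {B} {G} α β disjoint = record
  { at = at ∘ splitAt k
  ; at-inj = splitAt-injective k ∘ inj _ _
  ; at-~ = λ i j → adj (splitAt k i) (splitAt k j)
  ; at-closed = λ {i} → closed (splitAt k i) }
  where
  open Graph G
  module α = Component α
  module β = Component β

  at : Fin k ⊎ Fin m → Fin n
  at = [ α.at , β.at ]′

  inj : ∀ x y → at x ≡ at y → x ≡ y
  inj (inj₁ i) (inj₁ j) eq = cong inj₁ (α.at-inj eq)
  inj (inj₁ i) (inj₂ j) eq = contradiction eq (disjoint i j)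
  inj (inj₂ i) (inj₁ j) eq = contradiction (sym eq) (disjoint j i)
  inj (inj₂ i) (inj₂ j) eq = cong inj₂ (β.at-inj eq)

  adj : ∀ x y → Pointwise (Graph._~_ A) (Graph._~_ B) x y ⇔ (at x ~ at y)
  adj (inj₁ i) (inj₁ j) = mk⇔ (λ { (inj₁ p) → Equivalence.to (α.at-~ i j) p })
                              (inj₁ ∘ Equivalence.from (α.at-~ i j))
  adj (inj₁ i) (inj₂ j) = mk⇔ (λ ()) λ i~j →
    let i′ , eq = α.at-closed i~j in contradiction eq (disjoint i′ j)
  adj (inj₂ i) (inj₁ j) = mk⇔ (λ ()) λ i~j →
    let i′ , eq = α.at-closed (~-sym i~j) in contradiction eq (disjoint i′ i)
  adj (inj₂ i) (inj₂ j) = mk⇔ (λ { (inj₂ p) → Equivalence.to (β.at-~ i j) p })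
                              (inj₂ ∘ Equivalence.from (β.at-~ i j))

  closed : ∀ x {v} → at x ~ v → ∃ λ j → at (splitAt k j) ≡ v
  closed (inj₁ i) i~v = let j , eq = α.at-closed i~v in
    j ↑ˡ m , trans (cong at (Fin.splitAt-↑ˡ k j m)) eq
  closed (inj₂ i) i~v = let j , eq = β.at-closed i~v in
    k ↑ʳ j , trans (cong at (Fin.splitAt-↑ʳ k m j)) eq

component-⇔ : {H H′ : Graph k} {G : Graph n} → (∀ i j → Graph._~_ H i j ⇔ Graph._~_ H′ i j) →
              Component H′ G → Component H G
component-⇔ H⇔H′ γ = record
  { at = at ; at-inj = at-inj ; at-~ = λ i j → ⇔.trans (H⇔H′ i j) (at-~ i j) ; at-closed = at-closed }
  where open Component γ

covered? : {H : Graph k} {G : Graph n} (γ : Component H G) →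
           ∀ v → Dec (∃ λ i → Component.at γ i ≡ v)
covered? γ v = any? (λ i → Component.at γ i ≟ v)

component-≅ : {H : Graph k} {G : Graph n} (γ : Component H G) →
              (∀ v → ∃ λ i → Component.at γ i ≡ v) → G ≅ H
component-≅ {H = H} {G} γ covers = φ , λ u v → ⇔.sym
  (subst₂ (λ x y → Graph._~_ H (proj₁ (covers u)) (proj₁ (covers v)) ⇔ Graph._~_ G x y)
          (proj₂ (covers u)) (proj₂ (covers v)) (at-~ _ _))
  where
  open Component γ
  φ = mk↔ₛ′ (proj₁ ∘ covers) at (λ i → at-inj {proj₁ (covers (at i))} {i} (proj₂ (covers (at i)))) (proj₂ ∘ covers)

Decomposition : ℕ → ℕ → Graph n → Set
Decomposition q m G = ∃ λ a → (a ≡ 0 ⊎ ¬ 2 ≤ q) × (G ≅ (a · K 3 ∪ S (suc m)))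

module _ {G : Graph (suc n)} {s : Fin (suc n)} (star : StarWithTriangles q G s) where
  open Graph G
  open StarWithTriangles star

  star-component : LeafEnumeration G s m → Component (S (suc m)) G
  star-component {m} leaves = record
    { at = at ; at-inj = inj _ _ ; at-~ = adj ; at-closed = λ {i} → closed i }
    where
    open LeafEnumeration leaves

    at : Fin (suc m) → Fin (suc n)
    at zero    = s
    at (suc i) = leafAt i

    inj : ∀ i j → at i ≡ at j → i ≡ j
    inj zero    zero    _  = refl
    inj zero    (suc j) eq = contradiction (center~leafAt j) (~-irrefl eq)
    inj (suc i) zero    eq = contradiction (center~leafAt i) (~-irrefl (sym eq))
    inj (suc i) (suc j) eq = cong suc (leafAt-inj eq)

    adj : ∀ i j → Graph._~_ (S (suc m)) i j ⇔ (at i ~ at j)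
    adj zero    zero    = mk⇔ (λ ()) (~-irrefl refl)
    adj zero    (suc j) = mk⇔ (λ _ → center~leafAt j) _
    adj (suc i) zero    = mk⇔ (λ _ → ~-sym (center~leafAt i)) _
    adj (suc i) (suc j) = mk⇔ (λ ()) λ i~j →
      ~-irrefl (sym (leaf (center~leafAt i) i~j)) (center~leafAt j)

    closed : ∀ i {v} → at i ~ v → ∃ λ j → at j ≡ v
    closed zero    s~v = let j , eq = leafAt-covers s~v in suc j , eq
    closed (suc i) i~v = zero , sym (leaf (center~leafAt i) i~v)

  triangle-component : ∀ {x y z} → x ~ y → x ~ z → y ~ z →
                       IsolatedTriangle G x → IsolatedTriangle G y → IsolatedTriangle G z →
                       Component (K 3) G
  triangle-component {x} {y} {z} x~y x~z y~z x-tri y-tri z-tri = record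
    { at = at ; at-inj = λ {i} {j} eq → decidable-stable (i ≟ j) λ i≢j → ~-irrefl eq (adj i j i≢j)
    ; at-~ = λ i j → mk⇔ (adj i j) (λ i~j → λ { refl → ~-irrefl refl i~j })
    ; at-closed = λ {i} → closed i }
    where
    at : Fin 3 → Fin (suc n)
    at 0F = x
    at 1F = y
    at 2F = z

    adj : ∀ i j → i ≢ j → at i ~ at j
    adj 0F 0F 0≢0 = contradiction refl 0≢0
    adj 0F 1F _   = x~y
    adj 0F 2F _   = x~z
    adj 1F 0F _   = ~-sym x~y
    adj 1F 1F 1≢1 = contradiction refl 1≢1
    adj 1F 2F _   = y~z
    adj 2F 0F _   = ~-sym x~z
    adj 2F 1F _   = ~-sym y~z
    adj 2F 2F 2≢2 = contradiction refl 2≢2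

    nbrs : ∀ {u a b} → IsolatedTriangle G u → u ~ a → u ~ b → a ~ b → ∀ {w} → u ~ w → w ≡ a ⊎ w ≡ b
    nbrs (_ , _ , _ , _ , _ , only) u~a u~b a~b u~w =
      two-values (λ a≡b → ~-irrefl a≡b a~b) (only u~a) (only u~b) (only u~w)

    closed : ∀ i {v} → at i ~ v → ∃ λ j → at j ≡ v
    closed 0F x~v = [ (λ eq → 1F , sym eq) , (λ eq → 2F , sym eq) ]′ (nbrs x-tri x~y x~z y~z x~v)
    closed 1F y~v = [ (λ eq → 0F , sym eq) , (λ eq → 2F , sym eq) ]′ (nbrs y-tri (~-sym x~y) y~z x~z y~v)
    closed 2F z~v = [ (λ eq → 0F , sym eq) , (λ eq → 1F , sym eq) ]′
                      (nbrs z-tri (~-sym x~z) (~-sym y~z) x~y z~v)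

  module _ (leaves : LeafEnumeration G s m) where
    open LeafEnumeration leaves

    private
      Outside : Component (l · K 3 ∪ S (suc m)) G → Set
      Outside γ = ∀ v → (∀ i → Component.at γ i ≢ v) → IsolatedTriangle G v × ¬ 2 ≤ q

      -- Adds triangles until every vertex is covered. Each round adds three vertices and spends one
      -- unit of fuel, so fuel plus covered vertices never drops below the order of `G`.
      grow : ∀ fuel a (γ : Component (a · K 3 ∪ S (suc m)) G) → Outside {a} γ →
             a ≡ 0 ⊎ ¬ 2 ≤ q → suc n ≤ fuel + (a * 3 + suc m) → Decomposition q m G
      grow fuel a γ outside a=0⊎q<2 bound
        with any? (¬? ∘ covered? γ)
      ... | no none = a , a=0⊎q<2 , component-≅ γ λ v → decidable-stable (covered? γ v) λ miss → none (v , miss)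
      ... | yes (x , x∉) with outside x (λ i eq → x∉ (i , eq))
      ...   | x-tri@(y , z , x~y , x~z , y~z , _) , q<2 = extend fuel bound
        where
        open Component γ

        nbr∉ : ∀ {u} → x ~ u → ∀ i → at i ≢ u
        -- The covered part is closed under adjacency, so the whole triangle of `x` is still
        -- uncovered.
        nbr∉ x~u i refl = x∉ (at-closed (~-sym x~u))

        tri : Component (K 3) G
        tri = triangle-component x~y x~z y~z x-tri (proj₁ (outside y (nbr∉ x~y))) (proj₁ (outside z (nbr∉ x~z)))

        disjoint : ∀ i j → Component.at tri i ≢ at j
        disjoint 0F j eq = x∉ (j , sym eq)
        disjoint 1F j eq = nbr∉ x~y j (sym eq)
        disjoint 2F j eq = nbr∉ x~z j (sym eq)

        γ⁺ : Component (suc a · K 3 ∪ S (suc m)) G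
        γ⁺ = component-⇔ (K₃∪-assoc (a · K 3) (S (suc m))) (component-∪ tri γ disjoint)

        outside⁺ : Outside {suc a} γ⁺
        outside⁺ v v∉ = outside v (λ i → v∉ (suc (suc (suc i))))

        extend : ∀ fuel → suc n ≤ fuel + (a * 3 + suc m) → Decomposition q m G
        -- Without fuel all vertices are already covered, and three more would not fit into `G`.
        extend zero bound = contradiction (ℕ.≤-trans (injective⇒≤ (Component.at-inj γ⁺)) bound)
          (ℕ.<⇒≱ (ℕ.m<n⇒m<1+n (ℕ.m<n⇒m<1+n (ℕ.n<1+n _))))
        extend (suc fuel) bound = grow fuel (suc a) γ⁺ outside⁺ (inj₂ q<2)
          (ℕ.≤-trans bound (ℕ.≤-trans (ℕ.≤-reflexive (sym (ℕ.+-suc fuel _)))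
            (ℕ.+-monoʳ-≤ fuel (ℕ.m≤n+m _ 2))))

    star-decomposition : Decomposition q m G
    star-decomposition = grow (suc n) 0 base outside (inj₁ refl) (ℕ.m≤m+n _ _)
      where
      base : Component (0 · K 3 ∪ S (suc m)) G
      base = component-⇔ (λ i j → mk⇔ (λ { (inj₂ p) → p }) inj₂) (star-component leaves)

      outside : Outside {0} base
      outside v v∉ with kind v
      ... | inj₁ v≡s        = contradiction (sym v≡s) (v∉ zero)
      ... | inj₂ (inj₁ s~v) = let i , eq = leafAt-covers s~v in contradiction eq (v∉ (suc i))
      ... | inj₂ (inj₂ tri) = tri

-- The saturation number and the extremal graphs on `suc n` vertices.

module _ {n q : ℕ} (1≤q : 1 ≤ q) (q+2≤n : q + 2 ≤ n) where

  room : 2 + q * 1 ≤ n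
  room rewrite ℕ.*-identityʳ q | ℕ.+-comm 2 q = q+2≤n

  S-saturated : Saturated (F q) (S (suc n))
  S-saturated = star-saturated {q = q} {G = S (suc n)} star-S 1≤q leaves-S λ _ _ _ → room

  isSat : IsSat (suc n) (F q) n
  isSat = (S (suc n) , S-saturated , star⇒tight {q = q} {G = S (suc n)} star-S) ,
          λ { _ (G , sat , refl) → saturated⇒≥ {q = q} {G = G} sat }

  -- Comparison with the star `S (suc n)` bounds the edges by `n` from above, so the lower bound is
  -- attained.
  SAT⇒star : {G : Graph (suc n)} → SAT (suc n) (F q) G → ∃ (StarWithTriangles q G)
  SAT⇒star {G} (sat , _ , minimal) =
    tight⇒star {q = q} {G = G} sat
      (ℕ.≤-antisym (saturated⇒≥ {q = q} {G = G} sat) (minimal n (proj₁ isSat)))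

  star⇒SAT : {G : Graph (suc n)} {s : Fin (suc n)} → StarWithTriangles q G s →
             LeafEnumeration G s m → ((i j : Fin m) → i ≢ j → 2 + q * 1 ≤ m) → SAT (suc n) (F q) G
  star⇒SAT {G = G} star leaves enough =
    star-saturated star 1≤q leaves enough ,
    subst (IsSat (suc n) (F q)) (sym (star⇒tight star)) isSat

  ≅S⇒SAT : {G : Graph (suc n)} → G ≅ S (suc n) → SAT (suc n) (F q) G
  ≅S⇒SAT {G} iso = star⇒SAT
    (star-≅ {G = G} {S (suc n)} iso star-S)
    (leaves-≅ {G = G} {S (suc n)} iso leaves-S)
    λ _ _ _ → room

  Extremal : Graph (suc n) → Set
  Extremal G = (G ≅ S (suc n)) ⊎
    (¬ 2 ≤ q × (Σ[ a ∈ ℕ ] (1 ≤ a × 3 * a < suc n × suc n ∸ 3 * a ≢ 3 ×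
                             (G ≅ (a · K 3 ∪ S (suc n ∸ 3 * a))))))

  -- The isomorphism equates the orders, which fixes the size of the star. With at least one
  -- triangle present that size is not 3, because a star part with two leaves contradicts
  -- saturation.
  decomposition⇒extremal : {G : Graph (suc n)} {s : Fin (suc n)} → Saturated (F q) G →
                           StarWithTriangles q G s → LeafEnumeration G s m →
                           Decomposition q m G → Extremal G
  decomposition⇒extremal {m = m} {G} _ _ _ (zero , _ , (φ , φ-~)) =
    inj₁ (subst (λ k → G ≅ S k) (sym (↔⇒≡ φ)) iso)
    where
    iso : G ≅ S (suc m)
    iso = φ , λ u v → ⇔.trans (φ-~ u v) (mk⇔ (λ { (inj₂ p) → p }) inj₂)
  decomposition⇒extremal {m = m} {G} {s} sat star leaves (suc a , inj₂ q<2 , iso) =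
    inj₂ (q<2 , suc a , s≤s z≤n , 3a<n , rest≢3
         , subst (λ k → G ≅ (suc a · K 3 ∪ S k)) (sym rest) iso)
    where
    order : suc n ≡ 3 * suc a + suc m
    order = trans (↔⇒≡ (proj₁ iso)) (cong (_+ suc m) (ℕ.*-comm (suc a) 3))

    rest : suc n ∸ 3 * suc a ≡ suc m
    rest = trans (cong (_∸ 3 * suc a) order) (ℕ.m+n∸m≡n (3 * suc a) (suc m))

    3a<n : 3 * suc a < suc n
    3a<n = subst (3 * suc a <_) (sym order) (ℕ.m<m+n _ (s≤s z≤n))

    rest≢3 : suc n ∸ 3 * suc a ≢ 3
    rest≢3 eq = two-leaves⇒¬saturated star 1≤q
      (subst (LeafEnumeration G s) (ℕ.suc-injective (trans (sym rest) eq)) leaves) sat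

  SAT⇒extremal : {G : Graph (suc n)} → SAT (suc n) (F q) G → Extremal G
  SAT⇒extremal {G} G∈SAT =
    let s , star   = SAT⇒star {G} G∈SAT
        m , leaves = leafEnumeration G s
    in decomposition⇒extremal (proj₁ G∈SAT) star leaves (star-decomposition star leaves)

≅triangles⇒SAT : {n : ℕ} → 3 ≤ n → {G : Graph (suc n)} (a m : ℕ) → m ≢ 3 → 0 < m →
                 G ≅ (a · K 3 ∪ S m) → SAT (suc n) (F 1) G
≅triangles⇒SAT 3≤n {G} a (suc m) m≢3 _ iso =
  star⇒SAT {q = 1} (s≤s z≤n) 3≤n
    (star-≅ {G = G} {a · K 3 ∪ S (suc m)} iso
      (star-∪ (a · K 3) (S (suc m)) (λ i → triangle-aK₃ a i , λ { (s≤s ()) }) star-S))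
    (leaves-≅ {G = G} {a · K 3 ∪ S (suc m)} iso (leaves-∪ (a · K 3) (S (suc m)) leaves-S))
    (enough m m≢3)
  where
  -- Two distinct leaves force `m` to be at least 2, and the exclusion of stars on 3 vertices raises
  -- this to the required 2 + q = 3.
  enough : ∀ m → suc m ≢ 3 → (i j : Fin m) → i ≢ j → 3 ≤ m
  enough 1 _ 0F 0F 0≢0 = contradiction refl 0≢0
  enough 2 3≢3 _ _ _ = contradiction refl 3≢3
  enough (suc (suc (suc _))) _ _ _ _ = s≤s (s≤s (s≤s z≤n))

theorem1p3 : (q n : ℕ) → 1 ≤ q → q + 3 ≤ n →
    IsSat n (K 1 ∨ (K 2 ∪ (q · K 1))) (n ∸ 1) ×
    (q ≡ 1 → (G : Graph n) →
    (SAT n (K 1 ∨ (K 2 ∪ (q · K 1))) G ⇔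
    ((G ≅ S n) ⊎
    (Σ[ a ∈ ℕ ] (1 ≤ a × 3 * a < n × n ∸ 3 * a ≢ 3 × (G ≅ ((a · K 3) ∪ S (n ∸ 3 * a)))))))) ×
    (2 ≤ q → (G : Graph n) →
    (SAT n (K 1 ∨ (K 2 ∪ (q · K 1))) G ⇔ (G ≅ S n)))
theorem1p3 q zero    1≤q q+3≤n = contradiction (ℕ.≤-trans (ℕ.m≤n+m 3 q) q+3≤n) λ ()
theorem1p3 q (suc n) 1≤q q+3≤n =
  isSat 1≤q q+2≤n ,
  (λ { refl G → mk⇔ (Sum.map₂ proj₂ ∘ SAT⇒extremal 1≤q q+2≤n {G})
                    [ ≅S⇒SAT 1≤q q+2≤n {G}
                    , (λ (a , _ , 3a<n , rest≢3 , iso) →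
                         ≅triangles⇒SAT q+2≤n {G} a _ rest≢3 (ℕ.m<n⇒0<n∸m 3a<n) iso) ]′ }) ,
  (λ 2≤q G → mk⇔ ([ id , (λ (q<2 , _) → contradiction 2≤q q<2) ]′ ∘ SAT⇒extremal 1≤q q+2≤n {G})
                 (≅S⇒SAT 1≤q q+2≤n {G}))
  where
  q+2≤n : q + 2 ≤ n
  q+2≤n = ℕ.≤-pred (subst (_≤ suc n) (ℕ.+-suc q 2) q+3≤n)
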